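{- Let $d\geq 2$ and $q\geq 2$ be integers, and let $H^<$ be an ordered $d$-degenerate graph on $n\geq 3$ vertices, with at least one edge, with interval chromatic number $\chi$, and with a degeneracy ordering $v_1,\dots,v_n$ of its vertices (each $v_i$ has at most $d$ neighbors among $v_1,\dots,v_{i-1}$). Let $p\geq 2$ be an integer such that for every edge $v_iv_j$ of $H^<$ with $i<j$, the vertices $v_i$ and $v_j$ have at most $p-1$ common neighbors among $v_1,\dots,v_{i-1}$. Then \[ r_<(H^<;q)\leq n^{60dp^{q-2}\lceil\log\chi\rceil^{q-1}}. \]
   Context: Logarithms are to base two. An ordered graph $G^<$ is a finite graph together with a linear order on its vertex set. The degeneracy ordering $v_1,\dots,v_n$ need not agree with this given vertex order. An ordered copy of $H^<$ in $G^<$ is given by an increasing injection $f\colon V(H)\to V(G)$ with $f(u)f(v)\in E(G)$ whenever $uv\in E(H)$. The interval chromatic number of $G^<$ is the minimum number of intervals (of the vertex order) into which $V(G)$ can be partitioned so that no two vertices in the same interval are adjacent. A graph is $d$-degenerate if each of its nonempty subgraphs has a vertex of degree at most $d$. $K_N^<$ is the ordered complete graph on $N$ vertices. The ordered Ramsey number $r_<(H^<;q)$ is the smallest $N$ such that every coloring of the edges of $K_N^<$ with $q$ colors contains a monochromatic ordered copy of $H^<$. -}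

module Defs where

open import Level using (0ℓ)
open import Data.Nat using (ℕ; _≤_)
open import Data.Fin using (Fin) renaming (_<_ to _<ᶠ_; _≤_ to _≤ᶠ_)
open import Data.Fin.Permutation using (Permutation′; _⟨$⟩ʳ_)
open import Data.Fin.Properties using (_<?_; _≟_)
open import Data.Fin.Subset using (Subset; Nonempty; _∈_)
open import Data.List using (length; filter; allFin)
open import Data.Product using (∃-syntax; _×_)
open import Function.Definitions using (Surjective)
open import Relation.Binary.Core using (Rel; _Preserves_⟶_)
open import Relation.Binary.Definitions using (Symmetric; Irreflexive) renaming (Decidable to Decidable₂)
open import Relation.Binary.PropositionalEquality using (_≡_; _≢_; ≢-sym)
open import Relation.Nullary using (¬_)
open import Relation.Nullary.Decidable using (_×-dec_; ¬?)
open import Relation.Unary using (Pred; Decidable)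

#_ : ∀ {n} {P : Pred (Fin n) 0ℓ} → Decidable P → ℕ
#_ {n} P? = length (filter P? (allFin n))

IsLeast : ∀ {ℓ} → Pred ℕ ℓ → Pred ℕ ℓ
IsLeast P m = P m × (∀ k → P k → m ≤ k)

-- A finite linearly ordered set with n elements is uniquely isomorphic to
-- Fin n, so the vertex set is Fin n and its given order is the order of Fin n.
record OrderedGraph (n : ℕ) : Set₁ where
  field
    Adj    : Rel (Fin n) 0ℓ
    Adj?   : Decidable₂ Adj
    sym    : Symmetric Adj
    irrefl : Irreflexive _≡_ Adj

open OrderedGraph public using (Adj; Adj?)

complete : ∀ N → OrderedGraph N
complete N = record
  { Adj    = _≢_
  ; Adj?   = λ u v → ¬? (u ≟ v)
  ; sym    = ≢-sym
  ; irrefl = λ u≡v u≢v → u≢v u≡v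
  }

record Subgraph {n} (G : OrderedGraph n) : Set₁ where
  field
    Vertices : Subset n
    Edge     : Rel (Fin n) 0ℓ
    Edge?    : Decidable₂ Edge
    sym      : Symmetric Edge
    edge⇒adj : ∀ {u v} → Edge u v → Adj G u v
    endpoint : ∀ {u v} → Edge u v → u ∈ Vertices

  degree : Fin n → ℕ
  degree v = # (Edge? v)

IsDegenerate : ∀ {n} → ℕ → OrderedGraph n → Set₁
IsDegenerate d G =
  (S : Subgraph G) → let open Subgraph S in
  Nonempty Vertices → ∃[ v ] (v ∈ Vertices × degree v ≤ d)

-- The sequence v₁, …, vₙ is given by a permutation π, with vᵢ = π ⟨$⟩ʳ i.
-- It is unrelated to the order of Fin n used for the vertices.
module _ {n} (G : OrderedGraph n) (π : Permutation′ n) where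

  private
    v : Fin n → Fin n
    v = π ⟨$⟩ʳ_

  backDegree : Fin n → ℕ
  backDegree i = # (λ k → (k <? i) ×-dec Adj? G (v i) (v k))

  backCodegree : Fin n → Fin n → ℕ
  backCodegree i j =
    # (λ k → (k <? i) ×-dec (Adj? G (v i) (v k) ×-dec Adj? G (v j) (v k)))

  IsDegeneracyOrdering : ℕ → Set
  IsDegeneracyOrdering d = ∀ i → backDegree i ≤ d

  BackCodegreesAtMost : ℕ → Set
  BackCodegreesAtMost c =
    ∀ i j → i <ᶠ j → Adj G (v i) (v j) → backCodegree i j ≤ c

-- A partition into k (nonempty) intervals, numbered from left to right, is a
-- monotone surjection onto Fin k: the parts are its fibres.
record IndependentIntervalPartition {n} (G : OrderedGraph n) (k : ℕ) : Set where
  field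
    part        : Fin n → Fin k
    monotone    : part Preserves _≤ᶠ_ ⟶ _≤ᶠ_
    surjective  : Surjective _≡_ _≡_ part
    independent : ∀ {u v} → part u ≡ part v → ¬ Adj G u v

IsIntervalChromaticNumber : ∀ {n} → OrderedGraph n → ℕ → Set
IsIntervalChromaticNumber G = IsLeast (IndependentIntervalPartition G)

-- Increasing maps are automatically injective.
record OrderedCopy {m n} (H : OrderedGraph m) (G : OrderedGraph n) : Set where
  field
    map        : Fin m → Fin n
    increasing : map Preserves _<ᶠ_ ⟶ _<ᶠ_
    preserves  : ∀ {u v} → Adj H u v → Adj G (map u) (map v)

-- Only the values of colour on edges of the graph matter; the remaining values
-- are never inspected.
record EdgeColouring {n} (G : OrderedGraph n) (q : ℕ) : Set where
  field
    colour : Fin n → Fin n → Fin q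
    sym    : ∀ u v → colour u v ≡ colour v u

record MonochromaticCopy {m n q} (H : OrderedGraph m) {G : OrderedGraph n}
                         (c : EdgeColouring G q) : Set where
  open EdgeColouring c using (colour)
  field
    copy : OrderedCopy H G
  open OrderedCopy copy public
  field
    shade         : Fin q
    monochromatic : ∀ {u v} → Adj H u v → colour (map u) (map v) ≡ shade

IsOrderedRamseyNumber : ∀ {n} → OrderedGraph n → (q : ℕ) → ℕ → Set
IsOrderedRamseyNumber H q =
  IsLeast (λ N → (c : EdgeColouring (complete N) q) → MonochromaticCopy H c)

{-# OPTIONS --safe #-}

-- Write L for the rounded logarithm of χ.  Say that a colour class is sparse
-- between two sets if its density there is below a power of n.  Treat the
-- colours one after the other, and suppose that the earlier colours are sparse
-- between any two of 2 ^ L ≥ χ consecutive blocks of vertices.  Embed H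
-- greedily in the next colour, in the degeneracy order, one vertex of H at a
-- time, keeping a set U i of candidates for every remaining vertex.  Each step
-- shrinks U i by a factor R, at most d times altogether.  If no vertex can be
-- chosen, the next colour is sparse between large subsets of some U i and U j
-- with i and j adjacent.
--
-- The earlier colours must still be sparse there.  A step that shrinks only U i
-- costs almost nothing: candidates with too many edges in the earlier colours
-- are discarded beforehand.  A step that shrinks both costs a factor R, and
-- there are at most p - 1 of those.  So density n ^ -s for the next colour needs
-- density about n ^ -(p s) for the earlier ones; this is the source of the
-- factor p for each colour.
--
-- A sparse pair becomes 2 ^ L pairwise sparse blocks after L rounds of taking
-- sparse pairs inside the two halves, which raises the loss to the power L for
-- each colour.  Once q - 1 colours are sparse between blocks of size n, they are
-- absent there, and H embeds in the last colour.
module Submission where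

open import Algebra.Properties.Semiring.Sum using ()
open import Data.Bool using (Bool; true; false; if_then_else_; _∧_; _∨_; T)
open import Data.Bool.Properties using (T?; ∧-comm; ∨-comm)
open import Data.Fin using (Fin; zero; suc; toℕ; fromℕ<; inject≤) renaming (_<_ to _<ᶠ_)
open import Data.Fin.Permutation using (Permutation′; _⟨$⟩ʳ_; _⟨$⟩ˡ_; inverseʳ)
open import Data.Fin.Properties using (any?; all?; pigeonhole; toℕ<n; toℕ-fromℕ<; toℕ-inject≤; toℕ-injective)
  renaming (_≟_ to _≟ᶠ_; _<?_ to _<ᶠ?_; <-cmp to <ᶠ-cmp; <⇒≢ to <ᶠ⇒≢)
open import Data.List using (List; []; _∷_; _++_; length; filter; take; drop; concat; tabulate; allFin)
  renaming (map to mapˡ; lookup to _‼_)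
open import Data.List.Membership.Propositional using (_∈_; find)
open import Data.List.Membership.Propositional.Properties using (∈-filter⁻; ∈-lookup)
open import Data.List.Properties using (length-++; length-take; length-drop; length-tabulate)
open import Data.List.Relation.Binary.Sublist.Propositional using (_⊆_; []; _∷_; _∷ʳ_; ⊆-refl; ⊆-trans; lookup)
open import Data.List.Relation.Binary.Sublist.Propositional.Properties
  using (take-⊆; drop-⊆; filter-⊆; ++⁺ˡ; ++⁺ʳ)
open import Data.List.Relation.Unary.All as All using (All; []; _∷_)
open import Data.List.Relation.Unary.All.Properties using (concat⁺) renaming (++⁺ to All-++⁺)
open import Data.List.Relation.Unary.AllPairs as AllPairs using (AllPairs; []; _∷_)
import Data.List.Relation.Unary.AllPairs.Properties as AllPairsₚ
open import Data.List.Relation.Unary.Any as Any using (here; there)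
open import Data.Nat
open import Data.Nat.Induction using (<-rec)
open import Data.Nat.ListAction using () renaming (sum to sumˡ)
open import Data.Nat.Logarithm using (⌈log₂_⌉; ⌈log₂⌉-mono-≤; ⌈log₂⌈n/2⌉⌉≡⌈log₂n⌉∸1; ⌈log₂2^n⌉≡n)
open import Data.Nat.Properties
open import Data.Nat.Tactic.RingSolver using (solve-∀)
open import Data.Product using (∃-syntax; _×_; _,_; proj₁; proj₂)
open import Data.Sum using (_⊎_; inj₁; inj₂)
open import Data.Unit using (tt)
open import Data.Vec as Vec using (Vec; []; _∷_)
open import Data.Vec.Properties using (lookup∘tabulate)
open import Function using (_∘_; id)
open import Level using (0ℓ)
open import Relation.Binary.Core using (Rel)
open import Relation.Binary.Definitions using (Tri; tri<; tri≈; tri>)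
open import Relation.Binary.PropositionalEquality
  using (_≡_; _≢_; refl; sym; trans; cong; cong₂; subst; subst₂; module ≡-Reasoning)
open import Relation.Nullary using (Dec; yes; no; does; ¬_; contradiction)
open import Relation.Nullary.Decidable using (_×-dec_; _→-dec_; ¬?; map′; decidable-stable)
open import Relation.Unary using (Decidable)
open import Defs
open Algebra.Properties.Semiring.Sum +-*-semiring
  using (sum; sum-cong-≗; ∑-distrib-+; ∑-comm; *-distribˡ-sum; sum-replicate-zero)

private variable
  I J : Set
  n : ℕ

-- Sums over indices and over lists, Markov's inequality and averaging.

sum-mono-≤ : {f g : Fin n → ℕ} → (∀ i → f i ≤ g i) → sum f ≤ sum g
sum-mono-≤ {zero}  f≤g = z≤n
sum-mono-≤ {suc n} f≤g = +-mono-≤ (f≤g zero) (sum-mono-≤ (f≤g ∘ suc))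

term≤sum : (f : Fin n → ℕ) → ∀ i → f i ≤ sum f
term≤sum f zero    = m≤m+n _ _
term≤sum f (suc i) = ≤-trans (term≤sum (f ∘ suc) i) (m≤n+m _ _)

sum-const-≤ : (f : Fin n → ℕ) → ∀ {c} → (∀ i → f i ≤ c) → sum f ≤ n * c
sum-const-≤ {zero}  f f≤c = z≤n
sum-const-≤ {suc n} f f≤c = +-mono-≤ (f≤c zero) (sum-const-≤ (f ∘ suc) (f≤c ∘ suc))

sum≤n*max : (f : Fin (suc n) → ℕ) → ∃[ i ] sum f ≤ suc n * f i
sum≤n*max {zero}  f = zero , ≤-refl
sum≤n*max {suc n} f with sum≤n*max (f ∘ suc)
... | i , ih with ≤-total (f zero) (f (suc i))
... | inj₁ f₀≤fᵢ = suc i , +-mono-≤ f₀≤fᵢ ih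
... | inj₂ fᵢ≤f₀ = zero , +-monoʳ-≤ (f zero) (≤-trans ih (*-monoʳ-≤ (suc n) fᵢ≤f₀))

total : (I → ℕ) → List I → ℕ
total f xs = sumˡ (mapˡ f xs)

total-mono-≤ : {f g : I → ℕ} (xs : List I) → (∀ {x} → x ∈ xs → f x ≤ g x) → total f xs ≤ total g xs
total-mono-≤ []       f≤g = z≤n
total-mono-≤ (x ∷ xs) f≤g = +-mono-≤ (f≤g (here refl)) (total-mono-≤ xs (f≤g ∘ there))

total-cong : {f g : I → ℕ} (xs : List I) → (∀ x → f x ≡ g x) → total f xs ≡ total g xs
total-cong []       f≡g = refl
total-cong (x ∷ xs) f≡g = cong₂ _+_ (f≡g x) (total-cong xs f≡g)

total-⊆ : (f : I → ℕ) {xs ys : List I} → xs ⊆ ys → total f xs ≤ total f ys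
total-⊆ f []         = z≤n
total-⊆ f (y ∷ʳ τ)   = ≤-trans (total-⊆ f τ) (m≤n+m _ (f y))
total-⊆ f (refl ∷ τ) = +-monoʳ-≤ _ (total-⊆ f τ)

term≤total : (f : I → ℕ) {x : I} {xs : List I} → x ∈ xs → f x ≤ total f xs
term≤total f (here refl) = m≤m+n _ _
term≤total f (there x∈)  = ≤-trans (term≤total f x∈) (m≤n+m _ _)

total-+ : (f g : I → ℕ) (xs : List I) → total (λ x → f x + g x) xs ≡ total f xs + total g xs
total-+ f g []       = refl
total-+ f g (x ∷ xs) = trans (cong (f x + g x +_) (total-+ f g xs)) (lemma (f x) (g x) _ _)
  where
  lemma : ∀ a b c d → a + b + (c + d) ≡ a + c + (b + d)
  lemma = solve-∀

total-* : (c : ℕ) (f : I → ℕ) (xs : List I) → total (λ x → c * f x) xs ≡ c * total f xs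
total-* c f []       = sym (*-zeroʳ c)
total-* c f (x ∷ xs) = trans (cong (c * f x +_) (total-* c f xs)) (sym (*-distribˡ-+ c (f x) _))

total-const : (c : ℕ) (xs : List I) → total (λ _ → c) xs ≡ length xs * c
total-const c []       = refl
total-const c (x ∷ xs) = cong (c +_) (total-const c xs)

total-const-≤ : (f : I → ℕ) {c : ℕ} (xs : List I) → (∀ {x} → x ∈ xs → f x ≤ c) → total f xs ≤ length xs * c
total-const-≤ f {c} xs f≤c = subst (total f xs ≤_) (total-const c xs) (total-mono-≤ xs f≤c)

total-sum : (f : Fin n → I → ℕ) (xs : List I) →
            total (λ x → sum (λ i → f i x)) xs ≡ sum (λ i → total (f i) xs)
total-sum {n} f []   = sym (sum-replicate-zero n)
total-sum f (x ∷ xs) = trans (cong (sum (λ i → f i x) +_) (total-sum f xs)) (sym (∑-distrib-+ (λ i → f i x) _))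

total-comm : (z : I → J → ℕ) (xs : List I) (ys : List J) →
             total (λ x → total (z x) ys) xs ≡ total (λ y → total (λ x → z x y) xs) ys
total-comm z []       ys = sym (trans (total-const 0 ys) (*-zeroʳ (length ys)))
total-comm z (x ∷ xs) ys = trans (cong (total (z x) ys +_) (total-comm z xs ys)) (sym (total-+ (z x) _ ys))

indicator : Bool → ℕ
indicator b = if b then 1 else 0

length-filter-total : {P : I → Set} (P? : Decidable P) (xs : List I) →
                      length (filter P? xs) ≡ total (λ x → indicator (does (P? x))) xs
length-filter-total P? []       = refl
length-filter-total P? (x ∷ xs) with does (P? x)
... | true  = cong suc (length-filter-total P? xs)
... | false = length-filter-total P? xs

-- Each excluded element carries more than `b / a` times the average of `f`, so at most a share
-- `a / b` of the list is excluded. Everything is multiplied out to avoid division and subtraction.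
markov : (a b : ℕ) (f : I → ℕ) (xs : List I) →
         b * length xs ≤
         b * length (filter (λ x → a * (f x * length xs) ≤? b * total f xs) xs) + a * length xs
markov {I} a b f xs = begin
  b * ℓ                          ≡⟨ cong (b *_) (sym split) ⟩
  b * (length (filter P? xs) + bad)      ≡⟨ *-distribˡ-+ b _ bad ⟩
  b * length (filter P? xs) + b * bad    ≤⟨ +-monoʳ-≤ (b * length (filter P? xs)) few-bad ⟩
  b * length (filter P? xs) + a * ℓ      ∎
  where
  open ≤-Reasoning
  ℓ = length xs
  t = total f xs
  P : I → Set
  P x = a * (f x * ℓ) ≤ b * t
  P? : ∀ x → Dec (P x)
  P? x = a * (f x * ℓ) ≤? b * t
  isBad : I → ℕ
  isBad x = if does (P? x) then 0 else 1
  bad = total isBad xs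

  split : length (filter P? xs) + bad ≡ ℓ
  split = trans (cong (_+ bad) (length-filter-total P? xs))
         (trans (sym (total-+ _ isBad xs))
         (trans (total-cong xs pointwise) (trans (total-const 1 xs) (*-identityʳ ℓ))))
    where
    pointwise : ∀ x → indicator (does (P? x)) + isBad x ≡ 1
    pointwise x with does (P? x)
    ... | true  = refl
    ... | false = refl

  unless : ∀ {Z : Set} (d : Dec Z) {c r : ℕ} → (¬ Z → c ≤ r) → c * (if does d then 0 else 1) ≤ r
  unless (yes _) {c} _ = ≤-trans (≤-reflexive (*-zeroʳ c)) z≤n
  unless (no ¬x) c≤r = ≤-trans (≤-reflexive (*-identityʳ _)) (c≤r ¬x)

  bad-term : ∀ x → suc (b * t) * isBad x ≤ a * ℓ * f x
  bad-term x = unless (P? x) (λ ¬p → ≤-trans (≰⇒> ¬p) (≤-reflexive (lemma a (f x) ℓ)))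
    where
    lemma : ∀ a f ℓ → a * (f * ℓ) ≡ a * ℓ * f
    lemma = solve-∀

  -- The successor records that excluded elements exceed the bound strictly. This matters if `t` is
  -- zero, when it forces `bad` to vanish.
  weighted : suc (b * t) * bad ≤ a * ℓ * t
  weighted = begin
    suc (b * t) * bad                       ≡⟨ total-* (suc (b * t)) isBad xs ⟨
    total (λ x → suc (b * t) * isBad x) xs  ≤⟨ total-mono-≤ xs (λ {x} _ → bad-term x) ⟩
    total (λ x → a * ℓ * f x) xs            ≡⟨ total-* (a * ℓ) f xs ⟩
    a * ℓ * t                               ∎

  cancel : ∀ t m → suc (b * t) * m ≤ a * ℓ * t → b * m ≤ a * ℓ
  cancel zero m le = ≤-trans (*-monoʳ-≤ b m≤0) (≤-trans (≤-reflexive (*-zeroʳ b)) z≤n)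
    where
    m≤0 : m ≤ 0
    m≤0 = ≤-trans (m≤m+n m _) (≤-trans le (≤-reflexive (*-zeroʳ (a * ℓ))))
  cancel t@(suc _) m le = *-cancelʳ-≤ (b * m) (a * ℓ) t (begin
    b * m * t        ≡⟨ lemma b m t ⟩
    b * t * m        ≤⟨ m≤n+m _ m ⟩
    suc (b * t) * m  ≤⟨ le ⟩
    a * ℓ * t        ∎)
    where
    lemma : ∀ b m t → b * m * t ≡ b * t * m
    lemma = solve-∀

  few-bad : b * bad ≤ a * ℓ
  few-bad = cancel t bad weighted

-- Count the pairs of an index and an element satisfying `P`. Every element lies in at least one
-- pair, so the index in most pairs meets a share `1 / n` of the list.
popular-index : {P : Fin n → I → Set} (P? : ∀ i x → Dec (P i x)) (xs : List I) → 0 < length xs →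
             (∀ {x} → x ∈ xs → ∃[ i ] P i x) → ∃[ i ] length xs ≤ n * length (filter (P? i) xs)
popular-index {zero}  P? (x ∷ xs) _ covered with () ← covered (here refl)
popular-index {suc n} P? xs _ covered with sum≤n*max (λ i → length (filter (P? i) xs))
... | i , max = i , (begin
  length xs                                                    ≡⟨ *-identityʳ _ ⟨
  length xs * 1                                                ≡⟨ total-const 1 xs ⟨
  total (λ _ → 1) xs                                           ≤⟨ total-mono-≤ xs one≤ ⟩
  total (λ x → sum (λ i → indicator (does (P? i x)))) xs       ≡⟨ total-sum (λ i x → indicator (does (P? i x))) xs ⟩
  sum (λ i → total (λ x → indicator (does (P? i x))) xs)       ≡⟨ sum-cong-≗ (λ i → length-filter-total (P? i) xs) ⟨
  sum (λ i → length (filter (P? i) xs))                        ≤⟨ max ⟩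
  suc n * length (filter (P? i) xs)                            ∎)
  where
  open ≤-Reasoning
  one≤ : ∀ {x} → x ∈ xs → 1 ≤ sum (λ i → indicator (does (P? i x)))
  one≤ {x} x∈xs with covered x∈xs
  ... | i , p = ≤-trans (lemma (P? i x) p) (term≤sum (λ i → indicator (does (P? i x))) i)
    where
    lemma : ∀ {Z : Set} (d : Dec Z) → Z → 1 ≤ indicator (does d)
    lemma (yes _) _ = ≤-refl
    lemma (no ¬x) x = contradiction x ¬x

-- Weights in ℕ, rather than a relation, let the edge counts of several colours be added.
edges : (I → J → ℕ) → List I → List J → ℕ
edges z xs ys = total (λ x → total (z x) ys) xs

edges-sym : {z : I → I → ℕ} → (∀ x y → z x y ≡ z y x) → ∀ xs ys → edges z xs ys ≡ edges z ys xs
edges-sym {z = z} z-sym xs ys = trans (total-comm z xs ys) (total-cong ys (λ y → total-cong xs (λ x → z-sym x y)))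

edges-⊆ : (z : I → J → ℕ) {xs xs′ : List I} {ys ys′ : List J} → xs ⊆ xs′ → ys ⊆ ys′ →
          edges z xs ys ≤ edges z xs′ ys′
edges-⊆ z {xs′ = xs′} τ σ = ≤-trans (total-⊆ _ τ) (total-mono-≤ xs′ (λ {x} _ → total-⊆ (z x) σ))

edges-+ : (z z′ : I → J → ℕ) (xs : List I) (ys : List J) →
          edges (λ x y → z x y + z′ x y) xs ys ≡ edges z xs ys + edges z′ xs ys
edges-+ z z′ xs ys = trans (total-cong xs (λ x → total-+ (z x) (z′ x) ys)) (total-+ _ _ xs)

positive-factor : ∀ m {n} → 0 < m * n → 0 < n
positive-factor m {zero}  0<mn = contradiction (≤-trans 0<mn (≤-reflexive (*-zeroʳ m))) λ ()
positive-factor m {suc n} _    = s≤s z≤n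

nonempty : {A : Set} (xs : List A) → 0 < length xs → ∃[ x ] x ∈ xs
nonempty (x ∷ xs) _ = x , here refl

-- Back degrees, and the accounting for one embedding step.

Graph : ℕ → Set
Graph n = Fin n → Fin n → Bool

tail : ∀ {n} → Graph (suc n) → Graph n
tail E i j = E (suc i) (suc j)

-- The recursion removes the first vertex, just as an embedding step does, so the effect of a step
-- on the count holds by computation.
backDeg : ∀ {n} → Graph n → Fin n → ℕ
backDeg E zero    = 0
backDeg E (suc i) = indicator (E zero (suc i)) + backDeg (tail E) i

backCodeg : ∀ {n} → Graph n → Fin n → Fin n → ℕ
backCodeg E zero    _       = 0
backCodeg E (suc i) zero    = 0
backCodeg E (suc i) (suc j) = indicator (E zero (suc i) ∧ E zero (suc j)) + backCodeg (tail E) i j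

if-true : ∀ {A : Set} {x y : A} {b} → T b → (if b then x else y) ≡ x
if-true {b = true} _ = refl

if-false : ∀ {A : Set} {x y : A} {b} → ¬ T b → (if b then x else y) ≡ y
if-false {b = true}  ¬b = contradiction tt ¬b
if-false {b = false} _  = refl

-- If a marks the sets being shrunk, an ordered pair with exactly one marked index
-- is counted twice in the row of that index and not at all in the other row, so
-- that only shrinking in the first index has to be estimated.
coef : Bool → Bool → ℕ
coef true  true  = 1
coef true  false = 2
coef false true  = 0
coef false false = 1

-- Since `q` is symmetric, the sum equals its transpose, and the coefficients of `(i , j)` and
-- `(j , i)` add up to 2.
sum-coef : ∀ {n} (a : Fin n → Bool) (q : Fin n → Fin n → ℕ) → (∀ i j → q i j ≡ q j i) →
           sum (λ i → sum (λ j → coef (a i) (a j) * q i j)) ≡ sum (λ i → sum (q i))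
sum-coef a q q-sym = *-cancelˡ-≡ _ _ 2 (begin
  2 * S                                                                 ≡⟨ cong (S +_) (+-identityʳ S) ⟩
  S + S                                                                 ≡⟨ cong (S +_) flipped ⟩
  S + sum (λ i → sum (λ j → coef (a j) (a i) * q i j))                  ≡⟨ ∑-distrib-+ (λ i → sum (p i)) (λ i → sum (p′ i)) ⟨
  sum (λ i → sum (p i) + sum (p′ i))
                                                                        ≡⟨ sum-cong-≗ (λ i → row i) ⟩
  sum (λ i → 2 * sum (q i))                                             ≡⟨ *-distribˡ-sum 2 (λ i → sum (q i)) ⟨
  2 * sum (λ i → sum (q i))                                             ∎)
  where
  open ≡-Reasoning
  p p′ : Fin _ → Fin _ → ℕ
  p i j = coef (a i) (a j) * q i j
  p′ i j = coef (a j) (a i) * q i j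
  S = sum (λ i → sum (p i))
  flipped : S ≡ sum (λ i → sum (p′ i))
  flipped = trans (∑-comm p) (sum-cong-≗ {x = λ i → sum (λ j → p j i)} {λ i → sum (p′ i)}
    (λ i → sum-cong-≗ {x = λ j → p j i} {p′ i} (λ j → cong (coef (a j) (a i) *_) (q-sym j i))))
  two : ∀ b c → coef b c + coef c b ≡ 2
  two true  true  = refl
  two true  false = refl
  two false true  = refl
  two false false = refl
  row : ∀ i → sum (p i) + sum (p′ i) ≡ 2 * sum (q i)
  row i = trans (sym (∑-distrib-+ (p i) (p′ i))) (trans
    (sum-cong-≗ {x = λ j → p i j + p′ i j} {λ j → 2 * q i j}
      (λ j → trans (sym (*-distribʳ-+ (q i j) (coef (a i) (a j)) _)) (cong (_* q i j) (two (a i) (a j)))))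
    (sym (*-distribˡ-sum 2 (q i))))

-- The weight pays for one factor `R` when a set shrinks. If both sets shrink, the second factor is
-- paid by the exponent, which then drops by one.
room-step : ∀ {R} → 0 < R → ∀ w c b b′ {k u v u′ v′} → k * R ^ (indicator (b ∧ b′) + c) ≤ w * (u * v) →
            (T b → u ≡ R * u′) → (T b′ → v ≡ R * v′) → (¬ T b → u ≡ u′) → (¬ T b′ → v ≡ v′) →
            k * R ^ c ≤ (if b ∨ b′ then R else 1) * w * (u′ * v′)
room-step {R} R>0 w c true true {k} {u′ = u′} {v′} le bu bv _ _ with refl ← bu tt | refl ← bv tt =
  *-cancelˡ-≤ R {{>-nonZero R>0}} (begin
    R * (k * R ^ c)                ≡⟨ lemma₁ R k (R ^ c) ⟩
    k * (R * R ^ c)                ≤⟨ le ⟩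
    w * (R * u′ * (R * v′))        ≡⟨ lemma₂ R w u′ v′ ⟩
    R * (R * w * (u′ * v′))        ∎)
  where
  open ≤-Reasoning
  lemma₁ : ∀ R k c → R * (k * c) ≡ k * (R * c)
  lemma₁ = solve-∀
  lemma₂ : ∀ R w u v → w * (R * u * (R * v)) ≡ R * (R * w * (u * v))
  lemma₂ = solve-∀
room-step {R} _ w c true false {u′ = u′} {v′} le bu _ _ bv with refl ← bu tt | refl ← bv (λ ()) =
  ≤-trans le (≤-reflexive (lemma R w u′ v′))
  where
  lemma : ∀ R w u v → w * (R * u * v) ≡ R * w * (u * v)
  lemma = solve-∀
room-step {R} _ w c false true {u′ = u′} {v′} le _ bv bu _ with refl ← bu (λ ()) | refl ← bv tt =
  ≤-trans le (≤-reflexive (lemma R w u′ v′))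
  where
  lemma : ∀ R w u v → w * (u * (R * v)) ≡ R * w * (u * v)
  lemma = solve-∀
room-step _ w c false false {u′ = u′} {v′} le _ _ bu bv with refl ← bu (λ ()) | refl ← bv (λ ()) =
  ≤-trans le (≤-reflexive (cong (_* (u′ * v′)) (sym (*-identityˡ w))))

-- Greedy embedding in one colour, with a potential for the earlier colours.

module _ {V : Set} (z : V → V → ℕ) (z-sym : ∀ x y → z x y ≡ z y x)
         {G : V → V → Set} (G? : ∀ x y → Dec (G x y))
         -- `N` bounds the number of vertices, `M` is a lower bound for the candidate sets, `R` the
         -- shrinking factor, `C` the sparsity asked of `z`, and `Θ` the unit of the potential.
         (N M R C Θ : ℕ) (M>0 : 0 < M) (R>0 : 0 < R) where

  good : V → V → ℕ
  good x y = indicator (does (G? x y))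

  -- E lists the remaining vertices in the degeneracy order.  The weight w i j
  -- starts out equal for all edges and gains a factor R whenever Uᵢ or Uⱼ
  -- shrinks, so that w i j * edges z (U i) (U j) is the density of z up to the
  -- shrinking caused by common neighbours; room bounds how much of that is
  -- still to come.  Multiplying out the denominators keeps everything in ℕ.
  record Configuration {n} (τ : ℕ) (E : Graph n) (U : Fin n → List V) : Set where
    field
      E-sym     : ∀ i j → E i j ≡ E j i
      m         : Fin n → ℕ
      M≤m       : ∀ i → M ≤ m i
      size      : ∀ i → length (U i) ≡ m i * R ^ backDeg E i
      w         : Fin n → Fin n → ℕ
      w-sym     : ∀ i j → w i j ≡ w j i
      w>0       : ∀ i j → T (E i j) → 0 < w i j
      room      : ∀ i j → T (E i j) → C * Θ * R ^ backCodeg E i j ≤ w i j * (length (U i) * length (U j))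
      potential : sum (λ i → sum (λ j → w i j * edges z (U i) (U j))) ≤ τ * Θ

  record Embedding {n} (E : Graph n) (U : Fin n → List V) : Set where
    field
      f      : Fin n → V
      f∈U    : ∀ i → f i ∈ U i
      f-good : ∀ i j → i <ᶠ j → T (E i j) → G (f i) (f j)

  -- Adjacency makes `i` and `j` distinct, so that one of the two sets can later be placed before
  -- the other.
  record SparsePair {n} (E : Graph n) (U : Fin n → List V) : Set where
    field
      i j      : Fin n
      adjacent : T (E i j)
      A B      : List V
      A⊆       : A ⊆ U i
      B⊆       : B ⊆ U j
      A-large  : M ≤ 2 * N * length A
      B-large  : M ≤ 2 * N * length B
      few-good : R * edges good A B ≤ 2 * N * (length A * length B)
      few-z    : C * edges z A B ≤ 4 * N ^ 3 * (length A * length B)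

  module Step {n τ} {E : Graph (suc n)} {U : Fin (suc n) → List V} (cfg : Configuration τ E U)
              (N≤τ : N ≤ τ) (τ>0 : 0 < τ) (τ+n : τ + suc n ≡ 2 * N) where
    open Configuration cfg
    open ≤-Reasoning

    a : Fin n → Bool
    a i = E zero (suc i)

    U⁺ : Fin n → List V
    U⁺ i = U (suc i)

    w⁺ : Fin n → Fin n → ℕ
    w⁺ i j = w (suc i) (suc j)

    size>0 : ∀ i → M ≤ length (U i)
    size>0 i = begin
      M                         ≤⟨ M≤m i ⟩
      m i                       ≡⟨ *-identityʳ _ ⟨
      m i * 1                   ≤⟨ *-monoʳ-≤ (m i) (m^n>0 R {{>-nonZero R>0}} (backDeg E i)) ⟩
      m i * R ^ backDeg E i     ≡⟨ size i ⟨
      length (U i)              ∎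

    -- The share of a single candidate `u` in row `i` of the potential; a pair with one shrinking
    -- index is charged to that index alone.
    F : Fin n → V → ℕ
    F i u = sum (λ j → coef (a i) (a j) * (w⁺ i j * total (z u) (U⁺ j)))

    -- The candidates without much more than the average weight of z-edges.  The
    -- ratio (1 + τ) / τ telescopes to 2 over the whole embedding, as τ runs
    -- from N to 2 N.
    B : Fin n → List V
    B i = filter (λ u → τ * (F i u * length (U⁺ i)) ≤? suc τ * total (F i) (U⁺ i)) (U⁺ i)

    B-large : ∀ i → length (U⁺ i) ≤ suc τ * length (B i)
    B-large i = +-cancelʳ-≤ (τ * length (U⁺ i)) _ _ (markov τ (suc τ) (F i) (U⁺ i))

    Bad : Fin n → V → Set
    Bad i x = T (a i) × length (filter (G? x) (B i)) * R < length (U⁺ i)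

    Bad? : ∀ i x → Dec (Bad i x)
    Bad? i x = T? (a i) ×-dec (_ <? _)

    total-F : ∀ i xs → total (F i) xs ≡ sum (λ j → coef (a i) (a j) * (w⁺ i j * edges z xs (U⁺ j)))
    total-F i xs = trans (total-sum (λ j u → coef (a i) (a j) * (w⁺ i j * total (z u) (U⁺ j))) xs)
      (sum-cong-≗ (λ j → trans (total-* (coef (a i) (a j)) _ xs)
        (cong (coef (a i) (a j) *_) (total-* (w⁺ i j) _ xs))))

    ψ⁺ : Fin n → Fin n → ℕ
    ψ⁺ i j = w⁺ i j * edges z (U⁺ i) (U⁺ j)

    rest≤ : sum (λ i → sum (ψ⁺ i)) ≤ τ * Θ
    rest≤ = begin
      sum (λ i → sum (ψ⁺ i))                              ≤⟨ sum-mono-≤ {f = λ i → sum (ψ⁺ i)} (λ i → m≤n+m (sum (ψ⁺ i)) _) ⟩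
      sum (λ i → sum (λ j → w (suc i) j * edges z (U (suc i)) (U j))) ≤⟨ m≤n+m _ _ ⟩
      sum (λ i → sum (λ j → w i j * edges z (U i) (U j)))  ≤⟨ potential ⟩
      τ * Θ                                                ∎

    suc-τ≤ : suc τ ≤ 2 * N
    suc-τ≤ = begin
      suc τ       ≡⟨ +-comm 1 τ ⟩
      τ + 1       ≤⟨ +-monoʳ-≤ τ (s≤s z≤n) ⟩
      τ + suc n   ≡⟨ τ+n ⟩
      2 * N       ∎

    n≤N : n ≤ N
    n≤N = +-cancelˡ-≤ N n N (begin
      N + n        ≤⟨ +-mono-≤ N≤τ (n≤1+n n) ⟩
      τ + suc n    ≡⟨ τ+n ⟩
      N + (N + 0)  ≡⟨ cong (N +_) (+-identityʳ N) ⟩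
      N + N        ∎)

    module Extend (x : V) (x-good : ∀ i → ¬ Bad i x) where

      keep : Fin n → ℕ
      keep i = m (suc i) * R ^ backDeg (tail E) i

      N∩B : Fin n → List V
      N∩B i = filter (G? x) (B i)

      -- Truncation to exactly `keep i` elements makes the loss precisely a factor `R`, so that
      -- sizes and weights stay matched by equations.
      U′ : Fin n → List V
      U′ i = if a i then take (keep i) (N∩B i) else U⁺ i

      U′-true : ∀ i → T (a i) → U′ i ≡ take (keep i) (N∩B i)
      U′-true i aᵢ = if-true aᵢ

      U′-false : ∀ i → ¬ T (a i) → U′ i ≡ U⁺ i
      U′-false i ¬aᵢ = if-false ¬aᵢ

      keep-true : ∀ i → T (a i) → length (U⁺ i) ≡ R * keep i
      keep-true i aᵢ = begin-equality
        length (U⁺ i)                                        ≡⟨ size (suc i) ⟩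
        m (suc i) * R ^ (indicator (a i) + backDeg (tail E) i) ≡⟨ cong (λ b → m (suc i) * R ^ (b + backDeg (tail E) i)) (if-true aᵢ) ⟩
        m (suc i) * (R * R ^ backDeg (tail E) i)             ≡⟨ lemma (m (suc i)) R _ ⟩
        R * keep i                                           ∎
        where
        lemma : ∀ m R k → m * (R * k) ≡ R * (m * k)
        lemma = solve-∀

      keep≤ : ∀ i → T (a i) → keep i ≤ length (N∩B i)
      keep≤ i aᵢ = *-cancelˡ-≤ R {{>-nonZero R>0}} (begin
        R * keep i              ≡⟨ keep-true i aᵢ ⟨
        length (U⁺ i)           ≤⟨ ≮⇒≥ (λ lt → x-good i (aᵢ , lt)) ⟩
        length (N∩B i) * R      ≡⟨ *-comm _ R ⟩
        R * length (N∩B i)      ∎)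

      size′ : ∀ i → length (U′ i) ≡ keep i
      size′ i with T? (a i)
      ... | yes aᵢ = trans (cong length (U′-true i aᵢ))
                           (trans (length-take (keep i) (N∩B i)) (m≤n⇒m⊓n≡m (keep≤ i aᵢ)))
      ... | no ¬aᵢ = trans (cong length (U′-false i ¬aᵢ)) (trans (size (suc i))
                           (cong (λ b → m (suc i) * R ^ (b + backDeg (tail E) i)) (if-false ¬aᵢ)))

      shrink : ∀ i → T (a i) → length (U⁺ i) ≡ R * length (U′ i)
      shrink i aᵢ = trans (keep-true i aᵢ) (cong (R *_) (sym (size′ i)))

      U′⊆B : ∀ i → T (a i) → U′ i ⊆ B i
      U′⊆B i aᵢ = subst (_⊆ B i) (sym (U′-true i aᵢ))
        (⊆-trans (take-⊆ (keep i) (N∩B i)) (filter-⊆ (G? x) (B i)))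

      U′⊆U : ∀ i → U′ i ⊆ U⁺ i
      U′⊆U i with T? (a i)
      ... | yes aᵢ = ⊆-trans (U′⊆B i aᵢ) (filter-⊆ _ (U⁺ i))
      ... | no ¬aᵢ = subst (_⊆ U⁺ i) (sym (U′-false i ¬aᵢ)) ⊆-refl

      x~U′ : ∀ i → T (a i) → ∀ {y} → y ∈ U′ i → G x y
      x~U′ i aᵢ y∈ = proj₂ (∈-filter⁻ (G? x) {xs = B i}
        (lookup (take-⊆ (keep i) (N∩B i)) (subst (_ ∈_) (U′-true i aᵢ) y∈)))

      w′ : Fin n → Fin n → ℕ
      w′ i j = (if a i ∨ a j then R else 1) * w⁺ i j

      w′-sym : ∀ i j → w′ i j ≡ w′ j i
      w′-sym i j = cong₂ (λ b w → (if b then R else 1) * w) (∨-comm (a i) (a j)) (w-sym (suc i) (suc j))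

      w′>0 : ∀ i j → T (tail E i j) → 0 < w′ i j
      w′>0 i j e = *-mono-≤ (scale>0 (a i ∨ a j)) (w>0 (suc i) (suc j) e)
        where
        scale>0 : ∀ b → 0 < (if b then R else 1)
        scale>0 true  = R>0
        scale>0 false = s≤s z≤n

      room′ : ∀ i j → T (tail E i j) →
              C * Θ * R ^ backCodeg (tail E) i j ≤ w′ i j * (length (U′ i) * length (U′ j))
      room′ i j e = room-step R>0 (w⁺ i j) (backCodeg (tail E) i j) (a i) (a j) {C * Θ} (room (suc i) (suc j) e) (shrink i) (shrink j)
        (λ ¬a → cong length (sym (U′-false i ¬a))) (λ ¬a → cong length (sym (U′-false j ¬a)))

      ψ′ : Fin n → Fin n → ℕ
      ψ′ i j = w′ i j * edges z (U′ i) (U′ j)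

      ψ′-sym : ∀ i j → ψ′ i j ≡ ψ′ j i
      ψ′-sym i j = cong₂ _*_ (w′-sym i j) (edges-sym z-sym (U′ i) (U′ j))

      ψ⁺-sym : ∀ i j → ψ⁺ i j ≡ ψ⁺ j i
      ψ⁺-sym i j = cong₂ _*_ (w-sym (suc i) (suc j)) (edges-sym z-sym (U⁺ i) (U⁺ j))

      -- All survivors lie in `B i`, so none has `F i` above `suc τ / τ` times the average, and they
      -- number exactly one in `R`.
      F-small : ∀ i → T (a i) → τ * (R * total (F i) (U′ i)) ≤ suc τ * total (F i) (U⁺ i)
      F-small i aᵢ = *-cancelʳ-≤ _ _ ℓ {{>-nonZero (≤-trans M>0 (size>0 (suc i)))}} (begin
        τ * (R * total (F i) (U′ i)) * ℓ                ≡⟨ lemma₁ τ R (total (F i) (U′ i)) ℓ ⟩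
        R * (τ * ℓ * total (F i) (U′ i))                ≡⟨ cong (R *_) (total-* (τ * ℓ) (F i) (U′ i)) ⟨
        R * total (λ u → τ * ℓ * F i u) (U′ i)          ≤⟨ *-monoʳ-≤ R (total-const-≤ _ (U′ i) pointwise) ⟩
        R * (length (U′ i) * (suc τ * t))               ≡⟨ *-assoc R (length (U′ i)) _ ⟨
        R * length (U′ i) * (suc τ * t)                 ≡⟨ cong (_* (suc τ * t)) (shrink i aᵢ) ⟨
        ℓ * (suc τ * t)                                 ≡⟨ *-comm ℓ _ ⟩
        suc τ * t * ℓ                                   ∎)
        where
        ℓ = length (U⁺ i)
        t = total (F i) (U⁺ i)
        lemma₁ : ∀ τ R T ℓ → τ * (R * T) * ℓ ≡ R * (τ * ℓ * T)
        lemma₁ = solve-∀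
        lemma₂ : ∀ τ ℓ f → τ * ℓ * f ≡ τ * (f * ℓ)
        lemma₂ = solve-∀
        pointwise : ∀ {u} → u ∈ U′ i → τ * ℓ * F i u ≤ suc τ * t
        pointwise {u} u∈ = ≤-trans (≤-reflexive (lemma₂ τ ℓ (F i u)))
          (proj₂ (∈-filter⁻ (λ u → τ * (F i u * ℓ) ≤? suc τ * t) {xs = U⁺ i} (lookup (U′⊆B i aᵢ) u∈)))

      -- If `U i` shrinks, the new factor `R` in the weights is offset by `F-small`, and shrinking
      -- `U j` as well only removes edges. Otherwise `coef` leaves only the pairs in which neither
      -- set shrinks, and these keep their weight.
      row : ∀ i → τ * sum (λ j → coef (a i) (a j) * ψ′ i j) ≤ suc τ * sum (λ j → coef (a i) (a j) * ψ⁺ i j)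
      row i with T? (a i)
      ... | yes aᵢ = begin
        τ * sum (λ j → coef (a i) (a j) * ψ′ i j)   ≤⟨ *-monoʳ-≤ τ (sum-mono-≤ (λ j → *-monoʳ-≤ (coef (a i) (a j)) (term j))) ⟩
        τ * sum (λ j → coef (a i) (a j) * (R * (w⁺ i j * edges z (U′ i) (U⁺ j))))
                                                    ≡⟨ cong (τ *_) (sum-cong-≗ (λ j → lemma (coef (a i) (a j)) R _)) ⟩
        τ * sum (λ j → R * (coef (a i) (a j) * (w⁺ i j * edges z (U′ i) (U⁺ j))))
                                                    ≡⟨ cong (τ *_) (*-distribˡ-sum R (λ j → coef (a i) (a j) * (w⁺ i j * edges z (U′ i) (U⁺ j)))) ⟨
        τ * (R * sum (λ j → coef (a i) (a j) * (w⁺ i j * edges z (U′ i) (U⁺ j))))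
                                                    ≡⟨ cong (λ s → τ * (R * s)) (total-F i (U′ i)) ⟨
        τ * (R * total (F i) (U′ i))                ≤⟨ F-small i aᵢ ⟩
        suc τ * total (F i) (U⁺ i)                  ≡⟨ cong (suc τ *_) (total-F i (U⁺ i)) ⟩
        suc τ * sum (λ j → coef (a i) (a j) * ψ⁺ i j) ∎
        where
        lemma : ∀ c R x → c * (R * x) ≡ R * (c * x)
        lemma = solve-∀
        scale : ∀ b b′ → T b → (if b ∨ b′ then R else 1) ≡ R
        scale true _ _ = refl
        term : ∀ j → ψ′ i j ≤ R * (w⁺ i j * edges z (U′ i) (U⁺ j))
        term j = begin
          (if a i ∨ a j then R else 1) * w⁺ i j * edges z (U′ i) (U′ j)
            ≡⟨ cong (λ r → r * w⁺ i j * edges z (U′ i) (U′ j)) (scale (a i) (a j) aᵢ) ⟩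
          R * w⁺ i j * edges z (U′ i) (U′ j)      ≤⟨ *-monoʳ-≤ (R * w⁺ i j) (edges-⊆ z (⊆-refl {x = U′ i}) (U′⊆U j)) ⟩
          R * w⁺ i j * edges z (U′ i) (U⁺ j)      ≡⟨ *-assoc R (w⁺ i j) _ ⟩
          R * (w⁺ i j * edges z (U′ i) (U⁺ j))    ∎
      ... | no ¬aᵢ = *-mono-≤ (n≤1+n τ) (sum-mono-≤ (λ j → go (a i) (a j) ¬aᵢ (edges-⊆ z (U′⊆U i) (U′⊆U j))))
        where
        go : ∀ b b′ {e e′ w} → ¬ T b → e′ ≤ e →
             coef b b′ * ((if b ∨ b′ then R else 1) * w * e′) ≤ coef b b′ * (w * e)
        go true  _     ¬b _ = contradiction tt ¬b
        go false true  _  _ = z≤n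
        go false false {w = w} _ e′≤e = *-monoʳ-≤ 1 (*-mono-≤ (≤-reflexive (*-identityˡ w)) e′≤e)

      potential′ : sum (λ i → sum (ψ′ i)) ≤ suc τ * Θ
      potential′ = *-cancelˡ-≤ τ {{>-nonZero τ>0}} (begin
        τ * sum (λ i → sum (ψ′ i))                                        ≡⟨ cong (τ *_) (sum-coef a ψ′ ψ′-sym) ⟨
        τ * sum (λ i → sum (λ j → coef (a i) (a j) * ψ′ i j))              ≡⟨ *-distribˡ-sum τ (λ i → sum (λ j → coef (a i) (a j) * ψ′ i j)) ⟩
        sum (λ i → τ * sum (λ j → coef (a i) (a j) * ψ′ i j))              ≤⟨ sum-mono-≤ row ⟩
        sum (λ i → suc τ * sum (λ j → coef (a i) (a j) * ψ⁺ i j))          ≡⟨ *-distribˡ-sum (suc τ) (λ i → sum (λ j → coef (a i) (a j) * ψ⁺ i j)) ⟨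
        suc τ * sum (λ i → sum (λ j → coef (a i) (a j) * ψ⁺ i j))          ≡⟨ cong (suc τ *_) (sum-coef a ψ⁺ ψ⁺-sym) ⟩
        suc τ * sum (λ i → sum (ψ⁺ i))                                     ≤⟨ *-monoʳ-≤ (suc τ) rest≤ ⟩
        suc τ * (τ * Θ)                                                    ≡⟨ lemma (suc τ) τ Θ ⟩
        τ * (suc τ * Θ)                                                    ∎)
        where
        lemma : ∀ a b c → a * (b * c) ≡ b * (a * c)
        lemma = solve-∀

      next : Configuration (suc τ) (tail E) U′
      next = record
        { E-sym = λ i j → E-sym (suc i) (suc j) ; m = m ∘ suc ; M≤m = M≤m ∘ suc ; size = size′
        ; w = w′ ; w-sym = w′-sym ; w>0 = w′>0 ; room = room′ ; potential = potential′ }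

      extend : x ∈ U zero → Embedding (tail E) U′ → Embedding E U
      extend x∈ emb = record { f = f′ ; f∈U = f′∈ ; f-good = f′-good }
        where
        open Embedding emb
        f′ : Fin (suc n) → V
        f′ zero    = x
        f′ (suc i) = f i
        f′∈ : ∀ i → f′ i ∈ U i
        f′∈ zero    = x∈
        f′∈ (suc i) = lookup (U′⊆U i) (f∈U i)
        f′-good : ∀ i j → i <ᶠ j → T (E i j) → G (f′ i) (f′ j)
        f′-good zero    (suc j) _         e = x~U′ j e (f∈U j)
        f′-good (suc i) (suc j) (s≤s i<j) e = f-good i j i<j e

      lift-pair : SparsePair (tail E) U′ → SparsePair E U
      lift-pair sp = record
        { i = suc i ; j = suc j ; adjacent = adjacent ; A = A ; B = B′
        ; A⊆ = ⊆-trans A⊆ (U′⊆U i) ; B⊆ = ⊆-trans B⊆ (U′⊆U j)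
        ; A-large = A-large ; B-large = B′-large ; few-good = few-good ; few-z = few-z }
        where open SparsePair sp renaming (B to B′; B-large to B′-large)

    -- One index `i` is blamed by a share `1 / n` of the candidates. Those vertices have few good
    -- neighbours in `B i`, and the potential bounds the weight of `z` there.
    stuck : (∀ {x} → x ∈ U zero → ∃[ i ] Bad i x) → SparsePair E U
    stuck all-bad with popular-index Bad? (U zero) (≤-trans M>0 (size>0 zero)) all-bad
    ... | i , many = record
      { i = zero ; j = suc i ; adjacent = aᵢ ; A = A ; B = B i
      ; A⊆ = filter-⊆ (Bad? i) (U zero) ; B⊆ = filter-⊆ _ (U⁺ i)
      ; A-large = begin
          M                     ≤⟨ size>0 zero ⟩
          length (U zero)       ≤⟨ U₀≤ ⟩
          N * length A          ≤⟨ *-monoˡ-≤ (length A) (m≤m+n N _) ⟩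
          2 * N * length A      ∎
      ; B-large = ≤-trans (size>0 (suc i)) Uᵢ≤
      ; few-good = begin
          R * edges good A (B i)                     ≡⟨ total-* R _ A ⟨
          total (λ x → R * total (good x) (B i)) A   ≤⟨ total-const-≤ _ A few ⟩
          length A * (2 * N * length (B i))          ≡⟨ lemma₁ (length A) N (length (B i)) ⟩
          2 * N * (length A * length (B i))          ∎
      ; few-z = *-cancelˡ-≤ w₀ {{>-nonZero (w>0 zero (suc i) aᵢ)}} (begin
          w₀ * (C * edges z A (B i))        ≤⟨ *-monoʳ-≤ w₀ (*-monoʳ-≤ C (edges-⊆ z (filter-⊆ (Bad? i) (U zero)) (filter-⊆ _ (U⁺ i)))) ⟩
          w₀ * (C * e)                      ≡⟨ lemma₂ w₀ C e ⟩
          C * (w₀ * e)                      ≤⟨ *-monoʳ-≤ C one-term ⟩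
          C * (2 * N * Θ)                   ≡⟨ lemma₃ C N Θ ⟩
          -- No vertex precedes the first one, so its `backCodeg` is zero and `room` applies with
          -- `R ^ 0`.
          2 * N * (C * Θ * 1)               ≤⟨ *-monoʳ-≤ (2 * N) (room zero (suc i) aᵢ) ⟩
          2 * N * (w₀ * (length (U zero) * length (U⁺ i)))
                                            ≤⟨ *-monoʳ-≤ (2 * N) (*-monoʳ-≤ w₀ (*-mono-≤ U₀≤ Uᵢ≤)) ⟩
          2 * N * (w₀ * (N * length A * (2 * N * length (B i))))
                                            ≡⟨ lemma₄ N w₀ (length A) (length (B i)) ⟩
          w₀ * (4 * N ^ 3 * (length A * length (B i))) ∎) }
      where
      A = filter (Bad? i) (U zero)
      w₀ = w zero (suc i)
      e = edges z (U zero) (U⁺ i)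
      U₀≤ : length (U zero) ≤ N * length A
      U₀≤ = ≤-trans many (*-monoˡ-≤ (length A) n≤N)
      Uᵢ≤ : length (U⁺ i) ≤ 2 * N * length (B i)
      Uᵢ≤ = ≤-trans (B-large i) (*-monoˡ-≤ (length (B i)) suc-τ≤)
      aᵢ : T (a i)
      aᵢ with nonempty A (positive-factor N (≤-trans (≤-trans M>0 (size>0 zero)) U₀≤))
      ... | x , x∈A = proj₁ (proj₂ (∈-filter⁻ (Bad? i) {xs = U zero} x∈A))
      few : ∀ {x} → x ∈ A → R * total (good x) (B i) ≤ 2 * N * length (B i)
      few {x} x∈A = begin
        R * total (good x) (B i)                 ≡⟨ cong (R *_) (length-filter-total (G? x) (B i)) ⟨
        R * length (filter (G? x) (B i))         ≡⟨ *-comm R _ ⟩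
        length (filter (G? x) (B i)) * R         ≤⟨ <⇒≤ (proj₂ (proj₂ (∈-filter⁻ (Bad? i) {xs = U zero} x∈A))) ⟩
        length (U⁺ i)                            ≤⟨ Uᵢ≤ ⟩
        2 * N * length (B i)                     ∎
      one-term : w₀ * e ≤ 2 * N * Θ
      one-term = begin
        w₀ * e                                                    ≤⟨ term≤sum (λ j → w zero j * edges z (U zero) (U j)) (suc i) ⟩
        sum (λ j → w zero j * edges z (U zero) (U j))             ≤⟨ term≤sum (λ i → sum (λ j → w i j * edges z (U i) (U j))) zero ⟩
        sum (λ i → sum (λ j → w i j * edges z (U i) (U j)))       ≤⟨ potential ⟩
        τ * Θ                                                     ≤⟨ *-monoˡ-≤ Θ (≤-trans (n≤1+n τ) suc-τ≤) ⟩
        2 * N * Θ                                                 ∎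
      lemma₁ : ∀ a N b → a * (2 * N * b) ≡ 2 * N * (a * b)
      lemma₁ = solve-∀
      lemma₂ : ∀ a b c → a * (b * c) ≡ b * (a * c)
      lemma₂ = solve-∀
      lemma₃ : ∀ C N Θ → C * (2 * N * Θ) ≡ 2 * N * (C * Θ * 1)
      lemma₃ = solve-∀
      lemma₄ : ∀ N w a b → 2 * N * (w * (N * a * (2 * N * b))) ≡ w * (4 * (N * (N * (N * 1))) * (a * b))
      lemma₄ = solve-∀

  -- Either some candidate for the first vertex is bad for no later one, and the rest is embedded in
  -- the reduced sets, or every candidate is blamed on some index.
  embed : ∀ {n τ} {E : Graph n} {U : Fin n → List V} → Configuration τ E U →
          N ≤ τ → 0 < τ → τ + n ≡ 2 * N → Embedding E U ⊎ SparsePair E U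
  embed {zero} cfg _ _ _ = inj₁ (record { f = λ () ; f∈U = λ () ; f-good = λ () })
  embed {suc n} {τ} {E} {U} cfg N≤τ τ>0 τ+n = search (Any.any? (λ x → ¬? (any? (λ i → Bad? i x))) (U zero))
    where
    open Step cfg N≤τ τ>0 τ+n
    search : Dec (Any.Any (λ x → ¬ (∃[ i ] Bad i x)) (U zero)) → Embedding E U ⊎ SparsePair E U
    search (no none) = inj₂ (stuck (λ {x} x∈ →
      decidable-stable (any? (λ i → Bad? i x)) (λ ¬bad → none (Any.map (λ { refl → ¬bad }) x∈))))
    search (yes some) with find some
    ... | x , x∈ , ¬bad with embed next (m≤n⇒m≤1+n N≤τ) (s≤s z≤n) (trans (sym (+-suc τ n)) τ+n)
      where open Extend x (λ i bad → ¬bad (i , bad))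
    ... | inj₁ emb  = inj₁ (Extend.extend x (λ i bad → ¬bad (i , bad)) x∈ emb)
    ... | inj₂ pair = inj₂ (Extend.lift-pair x (λ i bad → ¬bad (i , bad)) pair)

-- Sublists, sorted lists and consecutive segments.

AllPairs-lookup : {A : Set} {S : Rel A 0ℓ} {xs : List A} → AllPairs S xs →
                  ∀ {i j} → i <ᶠ j → S (xs ‼ i) (xs ‼ j)
AllPairs-lookup {xs = _ ∷ xs} (ps ∷ _) {zero}  {suc j} _         = All.lookup ps (∈-lookup j)
AllPairs-lookup               (_ ∷ qs) {suc i} {suc j} (s≤s i<j) = AllPairs-lookup qs i<j

AllPairs-⊆ : {A : Set} {S : Rel A 0ℓ} {xs ys : List A} → xs ⊆ ys → AllPairs S ys → AllPairs S xs
AllPairs-⊆ []         []       = []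
AllPairs-⊆ (_ ∷ʳ τ)   (_ ∷ qs) = AllPairs-⊆ τ qs
AllPairs-⊆ (refl ∷ τ) (ps ∷ qs) = All.tabulate (λ x∈ → All.lookup ps (lookup τ x∈)) ∷ AllPairs-⊆ τ qs

take-drop-related : {A : Set} {S : Rel A 0ℓ} {xs : List A} → AllPairs S xs →
                    ∀ m {x y} → x ∈ take m xs → y ∈ drop m xs → S x y
take-drop-related (ps ∷ _)  (suc m) (here refl) y∈ = All.lookup ps (lookup (drop-⊆ m _) y∈)
take-drop-related (_ ∷ qs)  (suc m) (there x∈)  y∈ = take-drop-related qs m x∈ y∈

∈⇒⊆-concat : {A : Set} {xs : List A} {xss : List (List A)} → xs ∈ xss → xs ⊆ concat xss
∈⇒⊆-concat {xss = _ ∷ xss} (here refl) = ++⁺ʳ (concat xss) ⊆-refl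
∈⇒⊆-concat {xss = ys ∷ _}  (there xs∈) = ++⁺ˡ ys (∈⇒⊆-concat xs∈)

length-concat : {A : Set} {m : ℕ} {xss : List (List A)} → All (λ xs → length xs ≡ m) xss →
                length (concat xss) ≡ length xss * m
length-concat []                         = refl
length-concat {xss = xs ∷ _} (eq ∷ eqs) = trans (length-++ xs) (cong₂ _+_ eq (length-concat eqs))

module _ {v : ℕ} where

  Sorted : List (Fin v) → Set
  Sorted = AllPairs _<ᶠ_

  infix 4 _≺_
  _≺_ : List (Fin v) → List (Fin v) → Set
  A ≺ B = ∀ {a b} → a ∈ A → b ∈ B → a <ᶠ b

  ≺-⊆ : ∀ {A A′ B B′} → A′ ⊆ A → B′ ⊆ B → A ≺ B → A′ ≺ B′
  ≺-⊆ τ σ A≺B a∈ b∈ = A≺B (lookup τ a∈) (lookup σ b∈)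

  -- The chunk with number `u` among consecutive chunks of length `m`. Vertices of `H` that share a
  -- block will get different chunks, in the right order.
  segment : ℕ → ∀ {n} → Fin n → List (Fin v) → List (Fin v)
  segment m zero    xs = take m xs
  segment m (suc u) xs = segment m u (drop m xs)

  segment-⊆ : ∀ m {n} (u : Fin n) xs → segment m u xs ⊆ xs
  segment-⊆ m zero    xs = take-⊆ m xs
  segment-⊆ m (suc u) xs = ⊆-trans (segment-⊆ m u (drop m xs)) (drop-⊆ m xs)

  length-segment : ∀ m {n} (u : Fin n) xs → n * m ≤ length xs → length (segment m u xs) ≡ m
  length-segment m {suc n} zero xs le =
    trans (length-take m xs) (m≤n⇒m⊓n≡m (≤-trans (m≤m+n m (n * m)) le))
  length-segment m {suc n} (suc u) xs le = length-segment m u (drop m xs) (begin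
    n * m              ≡⟨ m+n∸m≡n m (n * m) ⟨
    m + n * m ∸ m      ≤⟨ ∸-monoˡ-≤ m le ⟩
    length xs ∸ m      ≡⟨ length-drop m xs ⟨
    length (drop m xs) ∎)
    where open ≤-Reasoning

  segment-≺ : ∀ m {n} {u u′ : Fin n} {xs} → Sorted xs → u <ᶠ u′ → segment m u xs ≺ segment m u′ xs
  segment-≺ m {u = zero}  {suc u′} {xs} sorted _ a∈ b∈ =
    take-drop-related sorted m a∈ (lookup (segment-⊆ m u′ (drop m xs)) b∈)
  segment-≺ m {u = suc u} {suc u′} sorted (s≤s lt) = segment-≺ m (AllPairsₚ.drop⁺ m sorted) lt

-- From sparse pairs to pairwise sparse blocks.

module _ {v : ℕ} (z : Fin v → Fin v → ℕ) (D : ℕ) where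

  record Pair (M : ℕ) (W : List (Fin v)) : Set where
    field
      A B     : List (Fin v)
      A⊆W     : A ⊆ W
      B⊆W     : B ⊆ W
      A≺B     : A ≺ B
      A-large : M ≤ length A
      B-large : M ≤ length B
      sparse  : D * edges z A B ≤ length A * length B

  -- In `2 ^ suc l`, a factor 4 comes from two uses of Markov's inequality and the rest from
  -- replacing a union of `2 ^ (l - 1)` blocks by one of them.
  record Blocks (l M : ℕ) (W : List (Fin v)) : Set where
    field
      blocks : List (List (Fin v))
      count  : length blocks ≡ 2 ^ l
      within : All (_⊆ W) blocks
      sizes  : All (λ X → length X ≡ M) blocks
      spread : AllPairs (λ X Y → X ≺ Y × D * edges z X Y ≤ 2 ^ suc l * (M * M)) blocks

  -- `Stop` is an outcome that ends the search, later a monochromatic copy. The factor `f` says how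
  -- much larger than the pair the ground set must be.
  HasPairs : Set → ℕ → Set
  HasPairs Stop f = ∀ M W → 0 < M → Sorted W → f * M ≤ length W → Stop ⊎ Pair M W

  HasBlocks : Set → ℕ → ℕ → Set
  HasBlocks Stop l f = ∀ M W → 0 < M → Sorted W → f * M ≤ length W → Stop ⊎ Blocks l M W

  markov-half : {A : Set} (F : A → ℕ) (xs : List A) {w : ℕ} → 2 * w ≤ length xs →
                w ≤ length (filter (λ x → 1 * (F x * length xs) ≤? 2 * total F xs) xs)
  markov-half F xs {w} le = *-cancelˡ-≤ 2 (≤-trans le (+-cancelʳ-≤ (1 * length xs) _ _
    (≤-trans (≤-reflexive (lemma (length xs))) (markov 1 2 F xs))))
    where
    lemma : ∀ ℓ → ℓ + 1 * ℓ ≡ 2 * ℓ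
    lemma = solve-∀

  module _ (z-sym : ∀ x y → z x y ≡ z y x) where

    module Halves {M W} (pair : Pair M W) (M>0 : 0 < M) where
      open Pair pair
      open ≤-Reasoning

      degree-to : List (Fin v) → Fin v → ℕ
      degree-to X u = total (z u) X

      low : List (Fin v) → List (Fin v) → List (Fin v)
      low Y X = filter (λ u → 1 * (degree-to X u * length Y) ≤? 2 * total (degree-to X) Y) Y

      -- Summing the degree bound over `Z`: the density to `X` at most doubles, however small `Z`
      -- is. Only membership is asked of `Z`, which will be a concatenation of blocks.
      low-⊆ : ∀ Y X {Z} → (∀ {u} → u ∈ Z → u ∈ low Y X) → length Y * edges z Z X ≤ length Z * (2 * edges z Y X)
      low-⊆ Y X {Z} τ = ≤-trans (≤-reflexive (sym (total-* (length Y) (degree-to X) Z)))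
        (total-const-≤ _ Z λ {u} u∈ → ≤-trans
          (≤-reflexive (lemma (length Y) (degree-to X u)))
          (proj₂ (∈-filter⁻ (λ u → 1 * (degree-to X u * length Y) ≤? 2 * total (degree-to X) Y) {xs = Y} (τ u∈))))
        where
        lemma : ∀ a b → a * b ≡ 1 * (b * a)
        lemma = solve-∀

      A-low : List (Fin v)
      A-low = low A B

      A-low-large : ∀ {w} → 2 * w ≤ M → w ≤ length A-low
      A-low-large 2w≤M = markov-half (degree-to B) A (≤-trans 2w≤M A-large)

      B-low : List (Fin v) → List (Fin v)
      B-low X = low B X

      B-low-large : ∀ X {w} → 2 * w ≤ M → w ≤ length (B-low X)
      B-low-large X 2w≤M = markov-half (degree-to X) B (≤-trans 2w≤M B-large)

      -- Passing from `A` to `X` and then from `B` to `Y` doubles the density twice. Replacing `X`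
      -- by its part `Z` removes edges, but the bound still refers to `X`.
      between : ∀ {X Y Z} → (∀ {u} → u ∈ X → u ∈ A-low) → Y ⊆ B-low X → Z ⊆ X →
                D * edges z Z Y ≤ 4 * (length X * length Y)
      between {X} {Y} {Z} X⊆ Y⊆ Z⊆X = *-cancelˡ-≤ (length A * length B) {{>-nonZero ℓ>0}} (begin
        length A * length B * (D * edges z Z Y)
          ≤⟨ *-monoʳ-≤ (length A * length B) (*-monoʳ-≤ D (edges-⊆ z Z⊆X (⊆-refl {x = Y}))) ⟩
        length A * length B * (D * edges z X Y)         ≡⟨ cong (λ e → length A * length B * (D * e)) (edges-sym z-sym X Y) ⟩
        length A * length B * (D * edges z Y X)         ≡⟨ lemma₁ (length A) (length B) D (edges z Y X) ⟩
        length A * D * (length B * edges z Y X)         ≤⟨ *-monoʳ-≤ (length A * D) (low-⊆ B X (lookup Y⊆)) ⟩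
        length A * D * (length Y * (2 * edges z B X))   ≡⟨ cong (λ e → length A * D * (length Y * (2 * e))) (edges-sym z-sym B X) ⟩
        length A * D * (length Y * (2 * edges z X B))   ≡⟨ lemma₂ (length A) D (length Y) (edges z X B) ⟩
        2 * D * length Y * (length A * edges z X B)     ≤⟨ *-monoʳ-≤ (2 * D * length Y) (low-⊆ A B X⊆) ⟩
        2 * D * length Y * (length X * (2 * edges z A B)) ≡⟨ lemma₃ D (length Y) (length X) (edges z A B) ⟩
        4 * (length X * length Y) * (D * edges z A B)   ≤⟨ *-monoʳ-≤ (4 * (length X * length Y)) sparse ⟩
        4 * (length X * length Y) * (length A * length B) ≡⟨ *-comm (4 * (length X * length Y)) _ ⟩
        length A * length B * (4 * (length X * length Y)) ∎)
        where
        ℓ>0 : 0 < length A * length B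
        ℓ>0 = *-mono-≤ (≤-trans M>0 A-large) (≤-trans M>0 B-large)
        lemma₁ : ∀ a b D e → a * b * (D * e) ≡ a * D * (b * e)
        lemma₁ = solve-∀
        lemma₂ : ∀ a D y e → a * D * (y * (2 * e)) ≡ 2 * D * y * (a * e)
        lemma₂ = solve-∀
        lemma₃ : ∀ D y x e → 2 * D * y * (x * (2 * e)) ≡ 4 * (x * y) * (D * e)
        lemma₃ = solve-∀

    -- The blocks of the second half must be sparse to the union of the blocks
    -- already found in the first half, so each half is first cut down to its
    -- vertices of at most twice the average degree.
    pairs⇒blocks : ∀ {Stop f} → 0 < f → HasPairs Stop f → ∀ l → HasBlocks Stop l ((2 * f) ^ l)
    pairs⇒blocks _ pairs zero M W _ _ le = inj₂ (record
      { blocks = take M W ∷ [] ; count = refl ; within = take-⊆ M W ∷ []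
      ; sizes = trans (length-take M W) (m≤n⇒m⊓n≡m (≤-trans (≤-reflexive (sym (*-identityˡ M))) le)) ∷ []
      ; spread = [] ∷ [] })
    pairs⇒blocks {Stop} {f} f>0 pairs (suc l) M W M>0 sorted le = halve
      -- Twice the size `w` is requested because restricting a half to its low vertices may lose
      -- half of it.
      (pairs (2 * w) W 2w>0 sorted (≤-trans (≤-reflexive (lemma f ((2 * f) ^ l) M)) le))
      where
      w = (2 * f) ^ l * M
      lemma : ∀ f g M → f * (2 * (g * M)) ≡ 2 * f * g * M
      lemma = solve-∀
      2w>0 : 0 < 2 * w
      2w>0 = *-mono-≤ {1} {2} (s≤s z≤n)
        (*-mono-≤ (m^n>0 (2 * f) {{>-nonZero (*-mono-≤ {1} {2} (s≤s z≤n) f>0)}} l) M>0)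

      halve : Stop ⊎ Pair (2 * w) W → Stop ⊎ Blocks (suc l) M W
      halve (inj₁ stop) = inj₁ stop
      halve (inj₂ pair) = left (recurse A-low-⊆ (A-low-large ≤-refl))
        where
        open Halves pair 2w>0
        open Pair pair

        recurse : ∀ {Y} → Y ⊆ W → w ≤ length Y → Stop ⊎ Blocks l M Y
        recurse {Y} τ = pairs⇒blocks f>0 pairs l M Y M>0 (AllPairs-⊆ τ sorted)

        A-low-⊆ : A-low ⊆ W
        A-low-⊆ = ⊆-trans (filter-⊆ _ A) A⊆W

        B-low-⊆ : ∀ X → B-low X ⊆ W
        B-low-⊆ X = ⊆-trans (filter-⊆ _ B) B⊆W

        left : Stop ⊎ Blocks l M A-low → Stop ⊎ Blocks (suc l) M W
        left (inj₁ stop) = inj₁ stop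
        left (inj₂ xs) = right (recurse (B-low-⊆ X) (B-low-large X ≤-refl))
          where
          module X = Blocks xs
          X = concat X.blocks
          right : Stop ⊎ Blocks l M (B-low X) → Stop ⊎ Blocks (suc l) M W
          right (inj₁ stop) = inj₁ stop
          right (inj₂ ys) = inj₂ (record
            { blocks = X.blocks ++ Y.blocks
            ; count  = trans (length-++ X.blocks)
                         (trans (cong₂ _+_ X.count Y.count) (cong (2 ^ l +_) (sym (+-identityʳ (2 ^ l)))))
            ; within = All-++⁺ (All.map (λ τ → ⊆-trans τ A-low-⊆) X.within)
                                (All.map (λ τ → ⊆-trans τ (B-low-⊆ X)) Y.within)
            ; sizes  = All-++⁺ X.sizes Y.sizes
            ; spread = AllPairsₚ.++⁺ (AllPairs.map weaken X.spread) (AllPairs.map weaken Y.spread)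
                         (All.tabulate λ x∈ → All.tabulate λ y∈ → across x∈ y∈) })
            where
            module Y = Blocks ys
            weaken : ∀ {P Q} → P ≺ Q × D * edges z P Q ≤ 2 ^ suc l * (M * M) →
                     P ≺ Q × D * edges z P Q ≤ 2 ^ suc (suc l) * (M * M)
            weaken (P≺Q , e≤) = P≺Q , ≤-trans e≤ (*-monoˡ-≤ (M * M) (m≤m+n (2 ^ suc l) _))
            X⊆ : ∀ {u} → u ∈ X → u ∈ A-low
            X⊆ = All.lookup (concat⁺ (All.map (λ τ → All.tabulate (lookup τ)) X.within))
            across : ∀ {P Q} → P ∈ X.blocks → Q ∈ Y.blocks →
                     P ≺ Q × D * edges z P Q ≤ 2 ^ suc (suc l) * (M * M)
            across {P} {Q} P∈ Q∈ =
              ≺-⊆ (⊆-trans (All.lookup X.within P∈) (filter-⊆ _ A))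
                  (⊆-trans (All.lookup Y.within Q∈) (filter-⊆ _ B)) A≺B ,
              (begin
                D * edges z P Q                      ≤⟨ between X⊆ (All.lookup Y.within Q∈) (∈⇒⊆-concat P∈) ⟩
                4 * (length X * length Q)            ≡⟨ cong₂ (λ x q → 4 * (x * q)) (length-concat X.sizes) (All.lookup Y.sizes Q∈) ⟩
                4 * (length X.blocks * M * M)        ≡⟨ cong (λ k → 4 * (k * M * M)) X.count ⟩
                4 * (2 ^ l * M * M)                  ≡⟨ lemma₂ (2 ^ l) M ⟩
                2 ^ suc (suc l) * (M * M)            ∎)
              where
              open ≤-Reasoning
              lemma₂ : ∀ k M → 4 * (k * M * M) ≡ 2 * (2 * k) * (M * M)
              lemma₂ = solve-∀

-- Agreement of the recursive counts with back degrees and codegrees.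

total-tabulate : {A : Set} {n : ℕ} (f : A → ℕ) (g : Fin n → A) → total f (tabulate g) ≡ sum (f ∘ g)
total-tabulate {n = zero}  f g = refl
total-tabulate {n = suc n} f g = cong (f (g zero) +_) (total-tabulate f (g ∘ suc))

#-sum : ∀ {n} {P : Fin n → Set} (P? : ∀ i → Dec (P i)) → # P? ≡ sum (λ i → indicator (does (P? i)))
#-sum {n} P? = trans (length-filter-total P? (allFin n)) (total-tabulate (λ i → indicator (does (P? i))) id)

-- Symmetry enters because the recursion looks from the earlier vertex and the sum from the later
-- one.
backDeg-sum : ∀ {n} (E : Graph n) → (∀ i j → E i j ≡ E j i) → ∀ i →
              backDeg E i ≡ sum (λ k → indicator (does (k <ᶠ? i) ∧ E i k))
backDeg-sum {suc n} E E-sym zero    = sym (sum-replicate-zero n)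
backDeg-sum {suc n} E E-sym (suc i) =
  cong₂ _+_ (cong indicator (E-sym zero (suc i))) (backDeg-sum (tail E) (λ i j → E-sym (suc i) (suc j)) i)

backCodeg-sum : ∀ {n} (E : Graph n) → (∀ i j → E i j ≡ E j i) → ∀ {i j} → i <ᶠ j →
                backCodeg E i j ≡ sum (λ k → indicator (does (k <ᶠ? i) ∧ (E i k ∧ E j k)))
backCodeg-sum {suc n} E E-sym {zero}  {suc j} _ = sym (sum-replicate-zero n)
backCodeg-sum {suc n} E E-sym {suc i} {suc j} (s≤s i<j) =
  cong₂ _+_ (cong₂ (λ b c → indicator (b ∧ c)) (E-sym zero (suc i)) (E-sym zero (suc j)))
            (backCodeg-sum (tail E) (λ i j → E-sym (suc i) (suc j)) i<j)

backCodeg-comm : ∀ {n} (E : Graph n) i j → backCodeg E i j ≡ backCodeg E j i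
backCodeg-comm E zero    zero    = refl
backCodeg-comm E zero    (suc j) = refl
backCodeg-comm E (suc i) zero    = refl
backCodeg-comm E (suc i) (suc j) =
  cong₂ _+_ (cong indicator (∧-comm (E zero (suc i)) _)) (backCodeg-comm (tail E) i j)

-- Candidate sets for the vertices of `H` inside the blocks.

module _ {n χ} (H : OrderedGraph n) (intervals : IndependentIntervalPartition H χ)
         (L : ℕ) (χ≤2^L : χ ≤ 2 ^ L) {v : ℕ} (z : Fin v → Fin v → ℕ) (D : ℕ) where
  open IndependentIntervalPartition intervals

  record Layout (m : ℕ) (W : List (Fin v)) : Set where
    field
      U       : Fin n → List (Fin v)
      U⊆W     : ∀ u → U u ⊆ W
      size    : ∀ u → length (U u) ≡ m
      ordered : ∀ {u w} → u <ᶠ w → U u ≺ U w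
      sparse  : ∀ {u w} → u <ᶠ w → Adj H u w → D * edges z (U u) (U w) ≤ 2 ^ suc L * (n * m * (n * m))

  -- The interval of `u` selects a block and `u` itself a chunk in it. Order comes from the blocks
  -- for different intervals and from the chunks within one. Adjacent vertices lie in different
  -- intervals, hence in blocks that are sparse to each other.
  layout : ∀ {m W} → Sorted W → Blocks z D L (n * m) W → Layout m W
  layout {m} {W} sorted bs = record { U = U ; U⊆W = U⊆W ; size = size ; ordered = ordered ; sparse = sparse }
    where
    open Blocks bs
    index : Fin n → Fin (length blocks)
    index u = inject≤ (part u) (≤-trans χ≤2^L (≤-reflexive (sym count)))
    V U : Fin n → List (Fin v)
    V u = blocks ‼ index u
    U u = segment m u (V u)
    V⊆W : ∀ u → V u ⊆ W
    V⊆W u = All.lookup within (∈-lookup (index u))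
    U⊆W : ∀ u → U u ⊆ W
    U⊆W u = ⊆-trans (segment-⊆ m u (V u)) (V⊆W u)
    size : ∀ u → length (U u) ≡ m
    size u = length-segment m u (V u) (≤-reflexive (sym (All.lookup sizes (∈-lookup (index u)))))
    index-< : ∀ {u w} → u <ᶠ w → part u ≢ part w → index u <ᶠ index w
    index-< {u} {w} u<w ≢ = subst₂ _<_ (sym (toℕ-inject≤ (part u) _)) (sym (toℕ-inject≤ (part w) _))
      (≤∧≢⇒< (monotone (<⇒≤ u<w)) (≢ ∘ toℕ-injective))
    ordered : ∀ {u w} → u <ᶠ w → U u ≺ U w
    ordered {u} {w} u<w with part u ≟ᶠ part w
    ... | yes eq = subst (λ i → segment m u (V u) ≺ segment m w (blocks ‼ i))
                     (cong (λ a → inject≤ a (≤-trans χ≤2^L (≤-reflexive (sym count)))) eq)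
                     (segment-≺ m (AllPairs-⊆ (V⊆W u) sorted) u<w)
    ... | no  ≢  = ≺-⊆ (segment-⊆ m u (V u)) (segment-⊆ m w (V w)) (proj₁ (AllPairs-lookup spread (index-< u<w ≢)))
    sparse : ∀ {u w} → u <ᶠ w → Adj H u w → D * edges z (U u) (U w) ≤ 2 ^ suc L * (n * m * (n * m))
    sparse {u} {w} u<w u~w = ≤-trans
      (*-monoʳ-≤ D (edges-⊆ z (segment-⊆ m u (V u)) (segment-⊆ m w (V w))))
      (proj₂ (AllPairs-lookup spread (index-< u<w (λ eq → independent eq u~w))))

-- One round: a copy in the next colour, or a pair sparse in one more colour.

T-does : {A : Set} (a? : Dec A) → T (does a?) → A
T-does (yes a) _ = a

does-T : {A : Set} (a? : Dec A) → A → T (does a?)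
does-T (yes _) _ = tt
does-T (no ¬a) a = contradiction a ¬a

does-⇔ : {A B : Set} (a? : Dec A) (b? : Dec B) → (A → B) → (B → A) → does a? ≡ does b?
does-⇔ (yes _) (yes _) _ _ = refl
does-⇔ (yes a) (no ¬b) f _ = contradiction (f a) ¬b
does-⇔ (no ¬a) (yes b) _ g = contradiction (g b) ¬a
does-⇔ (no _)  (no _)  _ _ = refl

module _ {n v q} (H : OrderedGraph n) (c : EdgeColouring (complete v) q) where
  open EdgeColouring c renaming (sym to colour-sym)

  monochromatic : (f : Fin n → Fin v) (a : Fin q) → (∀ {u w} → u <ᶠ w → f u <ᶠ f w) →
                  (∀ {u w} → u <ᶠ w → Adj H u w → colour (f u) (f w) ≡ a) → MonochromaticCopy H c
  monochromatic f a increasing shaded = record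
    { copy = record { map = f ; increasing = increasing ; preserves = distinct }
    ; shade = a ; monochromatic = λ {u} {w} → shaded′ u w }
    where
    distinct : ∀ {u w} → Adj H u w → f u ≢ f w
    distinct {u} {w} u~w with <ᶠ-cmp u w
    ... | tri< u<w _ _ = <ᶠ⇒≢ (increasing u<w)
    ... | tri≈ _ u≡w _ = contradiction u~w (OrderedGraph.irrefl H u≡w)
    ... | tri> _ _ w<u = <ᶠ⇒≢ (increasing w<u) ∘ sym
    shaded′ : ∀ u w → Adj H u w → colour (f u) (f w) ≡ a
    shaded′ u w u~w with <ᶠ-cmp u w
    ... | tri< u<w _ _ = shaded u<w u~w
    ... | tri≈ _ u≡w _ = contradiction u~w (OrderedGraph.irrefl H u≡w)
    ... | tri> _ _ w<u = trans (colour-sym (f u) (f w)) (shaded w<u (OrderedGraph.sym H u~w))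

module Colouring {n χ} (H : OrderedGraph n) (intervals : IndependentIntervalPartition H χ)
                 (L : ℕ) (χ≤2^L : χ ≤ 2 ^ L) (2^L≤n³ : 2 ^ suc L ≤ n ^ 3) (3≤n : 3 ≤ n)
                 (π : Permutation′ n) {d p′ : ℕ} (0<p′ : 0 < p′)
                 (degrees : IsDegeneracyOrdering H π d) (codegrees : BackCodegreesAtMost H π p′)
                 {v q} (c : EdgeColouring (complete v) q) where
  open EdgeColouring c renaming (sym to colour-sym)
  open ≤-Reasoning

  n≢0 : NonZero n
  n≢0 = >-nonZero (≤-trans (s≤s z≤n) 3≤n)

  coloured? : ∀ k x y → Dec (toℕ (colour x y) ≡ k)
  coloured? k x y = toℕ (colour x y) ≟ k

  -- The indicator of a colour number less than `k`, built one colour at a time so that a new colour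
  -- adds its own edge count.
  below : ℕ → Fin v → Fin v → ℕ
  below zero    x y = 0
  below (suc k) x y = below k x y + indicator (does (coloured? k x y))

  below-sym : ∀ k x y → below k x y ≡ below k y x
  below-sym zero    x y = refl
  below-sym (suc k) x y =
    cong₂ _+_ (below-sym k x y) (cong (λ a → indicator (does (toℕ a ≟ k))) (colour-sym x y))

  below≡0 : ∀ k {x y} → below k x y ≡ 0 → k ≤ toℕ (colour x y)
  below≡0 zero    _ = z≤n
  below≡0 (suc k) {x} {y} eq = ≤∧≢⇒< (below≡0 k (m+n≡0⇒m≡0 (below k x y) eq))
    (λ k≡ → case (coloured? k x y) (sym k≡) (m+n≡0⇒n≡0 (below k x y) eq))
    where
    case : ∀ {A : Set} (a? : Dec A) → A → indicator (does a?) ≢ 0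
    case (yes _) _ ()
    case (no ¬a) a _ = ¬a a

  E : Graph n
  E i j = does (Adj? H (π ⟨$⟩ʳ i) (π ⟨$⟩ʳ j))

  E-sym : ∀ i j → E i j ≡ E j i
  E-sym i j = does-⇔ (Adj? H _ _) (Adj? H _ _) (OrderedGraph.sym H) (OrderedGraph.sym H)

  E-adj : ∀ {i j} → T (E i j) → Adj H (π ⟨$⟩ʳ i) (π ⟨$⟩ʳ j)
  E-adj = T-does (Adj? H _ _)

  backDeg≤d : ∀ i → backDeg E i ≤ d
  backDeg≤d i = ≤-trans (≤-reflexive (trans (backDeg-sum E E-sym i) (sym (#-sum (λ k → (k <ᶠ? i) ×-dec Adj? H (π ⟨$⟩ʳ i) (π ⟨$⟩ʳ k)))))) (degrees i)

  backCodeg≡ : ∀ {i j} → i <ᶠ j → backCodeg E i j ≡ backCodegree H π i j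
  backCodeg≡ {i} {j} i<j = trans (backCodeg-sum E E-sym i<j)
    (sym (#-sum (λ k → (k <ᶠ? i) ×-dec (Adj? H (π ⟨$⟩ʳ i) (π ⟨$⟩ʳ k) ×-dec Adj? H (π ⟨$⟩ʳ j) (π ⟨$⟩ʳ k)))))

  backCodeg≤p′ : ∀ i j → T (E i j) → backCodeg E i j ≤ p′
  backCodeg≤p′ i j e with <ᶠ-cmp i j
  ... | tri< i<j _ _ = ≤-trans (≤-reflexive (backCodeg≡ i<j)) (codegrees i j i<j (E-adj e))
  ... | tri≈ _ i≡j _ = contradiction (E-adj e) (OrderedGraph.irrefl H (cong (π ⟨$⟩ʳ_) i≡j))
  ... | tri> _ _ j<i = ≤-trans (≤-reflexive (trans (backCodeg-comm E i j) (backCodeg≡ j<i)))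
                               (codegrees j i j<i (OrderedGraph.sym H (E-adj e)))

  4≤n² : 4 ≤ n ^ 2
  4≤n² = ≤-trans (m≤m+n 4 5) (^-monoˡ-≤ 2 3≤n)

  8≤n² : 8 ≤ n ^ 2
  8≤n² = ≤-trans (m≤m+n 8 1) (^-monoˡ-≤ 2 3≤n)

  -- The exponent e of D is chosen so that e + 15 = p (s + 15), for p = suc p′,
  -- which absorbs all polynomial losses of one round; so the exponents grow
  -- geometrically over the colours.
  module Pairs (k s : ℕ) (k<q : k < q) where
    R D : ℕ
    -- The extra `n ^ 3` absorbs the polynomial factors in `SparsePair`, leaving half of the density
    -- `n ^ -s` for the new colour and, as `C` is `8 * R`, half for the old ones.
    R = n ^ (s + 3)
    D = n ^ (suc p′ * s + 15 * p′)

    R>0 : 0 < R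
    R>0 = m^n>0 n {{n≢0}} (s + 3)

    -- The left side is at most `n ^ 8 * R ^ suc p′`. In the exponents, `0 < p′` gives 11 ≤ 12 `p′`,
    -- which is where the 15 in `D` comes from.
    D-large : n * (8 * R * R ^ p′) * (2 ^ suc L * (n * n)) ≤ D
    D-large = begin
      n * (8 * R * R ^ p′) * (2 ^ suc L * (n * n))  ≤⟨ *-mono-≤ (*-monoʳ-≤ n (*-monoˡ-≤ (R ^ p′) (*-monoˡ-≤ R 8≤n²))) (*-monoˡ-≤ (n * n) 2^L≤n³) ⟩
      n * (n ^ 2 * R * R ^ p′) * (n ^ 3 * (n * n))  ≡⟨ lemma n (n ^ 2) R (R ^ p′) (n ^ 3) ⟩
      n ^ 2 * n ^ 3 * (n ^ 3 * (R ^ suc p′))        ≡⟨ cong (λ x → n ^ 2 * n ^ 3 * (n ^ 3 * x)) (^-*-assoc n (s + 3) (suc p′)) ⟩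
      n ^ 2 * n ^ 3 * (n ^ 3 * n ^ ((s + 3) * suc p′))
                                                    ≡⟨ cong₂ _*_ (sym (^-distribˡ-+-* n 2 3)) (sym (^-distribˡ-+-* n 3 ((s + 3) * suc p′))) ⟩
      n ^ 5 * n ^ (3 + (s + 3) * suc p′)            ≡⟨ ^-distribˡ-+-* n 5 (3 + (s + 3) * suc p′) ⟨
      n ^ (8 + (s + 3) * suc p′)                    ≤⟨ ^-monoʳ-≤ n {{n≢0}} exponent ⟩
      n ^ (suc p′ * s + 15 * p′)                    ∎
      where
      lemma : ∀ n a R r b → n * (a * R * r) * (b * (n * n)) ≡ a * b * (n * (n * (n * 1)) * (R * r))
      lemma = solve-∀
      lemma₁ : ∀ s p → 8 + (s + 3) * suc p ≡ 11 + (3 * p + suc p * s)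
      lemma₁ = solve-∀
      lemma₂ : ∀ s p → 12 * p + (3 * p + suc p * s) ≡ suc p * s + 15 * p
      lemma₂ = solve-∀
      exponent : 8 + (s + 3) * suc p′ ≤ suc p′ * s + 15 * p′
      exponent = begin
        8 + (s + 3) * suc p′              ≡⟨ lemma₁ s p′ ⟩
        11 + (3 * p′ + suc p′ * s)        ≤⟨ +-monoˡ-≤ _ (≤-trans (m≤m+n 11 1) (*-monoʳ-≤ 12 0<p′)) ⟩
        12 * p′ + (3 * p′ + suc p′ * s)   ≡⟨ lemma₂ s p′ ⟩
        suc p′ * s + 15 * p′              ∎

    module _ {M W} (M>0 : 0 < M) (lay : Layout H intervals L χ≤2^L (below k) D (2 * n * M * R ^ d) W) where
      open Layout lay
      μ m C Θ : ℕ
      -- A set shrinks at most `d` times, so a start with `μ * R ^ d` leaves at least `μ`; the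
      -- factor `2 * n` is what `SparsePair` may lose.
      μ = 2 * n * M
      m = μ * R ^ d
      C = 8 * R
      Θ = m * m

      μ>0 : 0 < μ
      μ>0 = *-mono-≤ (*-mono-≤ {1} {2} (s≤s z≤n) (≤-trans (s≤s z≤n) 3≤n)) M>0

      U′ : Fin n → List (Fin v)
      U′ i = U (π ⟨$⟩ʳ i)

      w : Fin n → Fin n → ℕ
      w i j = if E i j then C * R ^ p′ else 0

      -- By `D-large`, each entry of the initial potential is at most `Θ / n`. The rows then sum to
      -- at most `Θ`, which allows the start at `τ = n`.
      few-edges : ∀ {i j} → T (E i j) → n * (C * R ^ p′) * edges (below k) (U′ i) (U′ j) ≤ Θ
      few-edges {i} {j} e = *-cancelˡ-≤ P {{P≢0}} (begin
        P * (n * (C * R ^ p′) * ε)      ≡⟨ lemma₁ P (n * (C * R ^ p′)) ε ⟩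
        n * (C * R ^ p′) * P * ε        ≤⟨ *-monoˡ-≤ ε D-large ⟩
        D * ε                           ≤⟨ bound ⟩
        2 ^ suc L * (n * m * (n * m))   ≡⟨ lemma₂ (2 ^ suc L) n m ⟩
        P * Θ                           ∎)
        where
        P = 2 ^ suc L * (n * n)
        P≢0 : NonZero P
        P≢0 = >-nonZero (*-mono-≤ (m^n>0 2 (suc L)) (*-mono-≤ (>-nonZero⁻¹ n {{n≢0}}) (>-nonZero⁻¹ n {{n≢0}})))
        ε = edges (below k) (U′ i) (U′ j)
        lemma₁ : ∀ P K e → P * (K * e) ≡ K * P * e
        lemma₁ = solve-∀
        lemma₂ : ∀ t n m → t * (n * m * (n * m)) ≡ t * (n * n) * (m * m)
        lemma₂ = solve-∀
        bound : D * ε ≤ 2 ^ suc L * (n * m * (n * m))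
        bound with <ᶠ-cmp (π ⟨$⟩ʳ i) (π ⟨$⟩ʳ j)
        ... | tri< u<w _ _ = sparse u<w (E-adj e)
        ... | tri≈ _ u≡w _ = contradiction (E-adj e) (OrderedGraph.irrefl H u≡w)
        ... | tri> _ _ w<u = ≤-trans (≤-reflexive (cong (D *_) (edges-sym (below-sym k) (U′ i) (U′ j))))
                                     (sparse w<u (OrderedGraph.sym H (E-adj e)))

      initial : Configuration (below k) (below-sym k) (coloured? k) n μ R C Θ μ>0 R>0 n E U′
      initial = record
        { E-sym = E-sym
        -- All sets start equally large; the factors `R` that a vertex with fewer than `d` earlier
        -- neighbours never spends are put into `m`.
        ; m = λ i → μ * R ^ (d ∸ backDeg E i)
        ; M≤m = λ i → m≤m*n μ (R ^ (d ∸ backDeg E i)) {{>-nonZero (m^n>0 R {{>-nonZero R>0}} (d ∸ backDeg E i))}}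
        ; size = λ i → trans (size _) (trans (cong (λ b → μ * R ^ b) (sym (m∸n+n≡m (backDeg≤d i))))
            (trans (cong (μ *_) (^-distribˡ-+-* R (d ∸ backDeg E i) (backDeg E i))) (sym (*-assoc μ _ _))))
        ; w = w
        ; w-sym = λ i j → cong (λ b → if b then C * R ^ p′ else 0) (E-sym i j)
        ; w>0 = λ i j e → ≤-trans (*-mono-≤ (*-mono-≤ {1} {8} (s≤s z≤n) R>0) (m^n>0 R {{>-nonZero R>0}} p′))
                                  (≤-reflexive (sym (if-true e)))
        ; room = room
        ; potential = begin
            sum (λ i → sum (ψ i))   ≤⟨ sum-const-≤ (λ i → sum (ψ i)) row ⟩
            n * Θ                   ∎ }
        where
        ψ : Fin n → Fin n → ℕ
        ψ i j = w i j * edges (below k) (U′ i) (U′ j)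
        term : ∀ i j → n * ψ i j ≤ Θ
        term i j with T? (E i j)
        ... | yes e = ≤-trans (≤-reflexive (trans (sym (*-assoc n _ _))
                        (cong (λ x → n * x * edges (below k) (U′ i) (U′ j)) (if-true e)))) (few-edges e)
        ... | no ¬e = ≤-trans (≤-reflexive (trans (cong (λ x → n * (x * edges (below k) (U′ i) (U′ j))) (if-false ¬e)) (*-zeroʳ n))) z≤n
        row : ∀ i → sum (ψ i) ≤ Θ
        row i = *-cancelˡ-≤ n {{n≢0}} (≤-trans (≤-reflexive (*-distribˡ-sum n (ψ i))) (sum-const-≤ (λ j → n * ψ i j) (term i)))
        room : ∀ i j → T (E i j) → C * Θ * R ^ backCodeg E i j ≤ w i j * (length (U′ i) * length (U′ j))
        room i j e = begin
          C * Θ * R ^ backCodeg E i j                      ≤⟨ *-monoʳ-≤ (C * Θ) (^-monoʳ-≤ R {{>-nonZero R>0}} (backCodeg≤p′ i j e)) ⟩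
          C * Θ * R ^ p′                                   ≡⟨ lemma C Θ (R ^ p′) ⟩
          C * R ^ p′ * Θ                                   ≡⟨ cong₂ _*_ (if-true e) (cong₂ _*_ (size (π ⟨$⟩ʳ i)) (size (π ⟨$⟩ʳ j))) ⟨
          w i j * (length (U′ i) * length (U′ j))          ∎
          where
          lemma : ∀ a b c → a * b * c ≡ a * c * b
          lemma = solve-∀

      -- The images are in order because the candidate sets are, independently of the order of
      -- embedding.
      from-embedding : Embedding (below k) (below-sym k) (coloured? k) n μ R C Θ μ>0 R>0 E U′ → MonochromaticCopy H c
      from-embedding emb = monochromatic H c g (fromℕ< k<q) increasing shaded
        where
        open Embedding emb
        g : Fin n → Fin v
        g u = f (π ⟨$⟩ˡ u)
        g∈U : ∀ u → g u ∈ U u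
        g∈U u = subst (λ w → g u ∈ U w) (inverseʳ π) (f∈U (π ⟨$⟩ˡ u))
        increasing : ∀ {u w} → u <ᶠ w → g u <ᶠ g w
        increasing u<w = ordered u<w (g∈U _) (g∈U _)
        E-of : ∀ {u w} → Adj H u w → T (E (π ⟨$⟩ˡ u) (π ⟨$⟩ˡ w))
        E-of u~w = does-T (Adj? H _ _) (subst₂ (Adj H) (sym (inverseʳ π)) (sym (inverseʳ π)) u~w)
        is-k : ∀ {x y} → toℕ (colour x y) ≡ k → colour x y ≡ fromℕ< k<q
        is-k eq = toℕ-injective (trans eq (sym (toℕ-fromℕ< k<q)))
        shaded : ∀ {u w} → u <ᶠ w → Adj H u w → colour (g u) (g w) ≡ fromℕ< k<q
        shaded {u} {w} u<w u~w with <ᶠ-cmp (π ⟨$⟩ˡ u) (π ⟨$⟩ˡ w)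
        ... | tri< i<j _ _ = is-k (f-good _ _ i<j (E-of u~w))
        ... | tri≈ _ i≡j _ = contradiction u~w (OrderedGraph.irrefl H
                               (trans (sym (inverseʳ π)) (trans (cong (π ⟨$⟩ʳ_) i≡j) (inverseʳ π))))
        ... | tri> _ _ j<i = trans (colour-sym (g u) (g w)) (is-k (f-good _ _ j<i (E-of (OrderedGraph.sym H u~w))))

      -- Old colours and new colour each use up half of the allowed density.
      from-sparse : SparsePair (below k) (below-sym k) (coloured? k) n μ R C Θ μ>0 R>0 E U′ →
                    Pair (below (suc k)) (n ^ s) M W
      from-sparse sp = oriented (<ᶠ-cmp (π ⟨$⟩ʳ i) (π ⟨$⟩ʳ j))
        where
        open SparsePair sp
        2n≢0 : NonZero (2 * n)
        2n≢0 = m*n≢0 2 n {{_}} {{n≢0}}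
        A-size : M ≤ length A
        A-size = *-cancelˡ-≤ (2 * n) {{2n≢0}} A-large
        B-size : M ≤ length B
        B-size = *-cancelˡ-≤ (2 * n) {{2n≢0}} B-large
        g = λ x y → indicator (does (coloured? k x y))
        ab = length A * length B
        R≡ : R ≡ n ^ s * n ^ 3
        R≡ = ^-distribˡ-+-* n s 3
        old : 2 * (n ^ s * edges (below k) A B) ≤ ab
        old = *-cancelˡ-≤ (4 * n ^ 3) {{m*n≢0 4 (n ^ 3) {{_}} {{m^n≢0 n 3 {{n≢0}}}}}} (begin
          4 * n ^ 3 * (2 * (n ^ s * edges (below k) A B))   ≡⟨ lemma (n ^ 3) (n ^ s) (edges (below k) A B) ⟩
          8 * (n ^ s * n ^ 3) * edges (below k) A B         ≡⟨ cong (λ r → 8 * r * edges (below k) A B) R≡ ⟨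
          8 * R * edges (below k) A B                       ≤⟨ few-z ⟩
          4 * n ^ 3 * ab                                    ∎)
          where
          lemma : ∀ a b e → 4 * a * (2 * (b * e)) ≡ 8 * (b * a) * e
          lemma = solve-∀
        new : 2 * (n ^ s * edges g A B) ≤ ab
        new = *-cancelˡ-≤ (2 * n) {{2n≢0}} (begin
          2 * n * (2 * (n ^ s * edges g A B))   ≡⟨ lemma₁ n (n ^ s) (edges g A B) ⟩
          4 * (n * n ^ s * edges g A B)         ≤⟨ *-monoˡ-≤ (n * n ^ s * edges g A B) 4≤n² ⟩
          n ^ 2 * (n * n ^ s * edges g A B)     ≡⟨ lemma₂ n (n ^ s) (edges g A B) ⟩
          n ^ s * n ^ 3 * edges g A B           ≡⟨ cong (_* edges g A B) R≡ ⟨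
          R * edges g A B                       ≤⟨ few-good ⟩
          2 * n * ab                            ∎)
          where
          lemma₁ : ∀ n a e → 2 * n * (2 * (a * e)) ≡ 4 * (n * a * e)
          lemma₁ = solve-∀
          lemma₂ : ∀ n a e → n * (n * 1) * (n * a * e) ≡ a * (n * (n * (n * 1))) * e
          lemma₂ = solve-∀
        both : n ^ s * edges (below (suc k)) A B ≤ ab
        both = *-cancelˡ-≤ 2 (begin
          2 * (n ^ s * edges (below (suc k)) A B)                 ≡⟨ cong (λ e → 2 * (n ^ s * e)) (edges-+ (below k) g A B) ⟩
          2 * (n ^ s * (edges (below k) A B + edges g A B))       ≡⟨ lemma (n ^ s) (edges (below k) A B) (edges g A B) ⟩
          2 * (n ^ s * edges (below k) A B) + 2 * (n ^ s * edges g A B) ≤⟨ +-mono-≤ old new ⟩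
          ab + ab                                                 ≡⟨ cong (ab +_) (+-identityʳ ab) ⟨
          2 * ab                                                  ∎)
          where
          lemma : ∀ a b c → 2 * (a * (b + c)) ≡ 2 * (a * b) + 2 * (a * c)
          lemma = solve-∀
        oriented : Tri _ _ _ → Pair (below (suc k)) (n ^ s) M W
        oriented (tri< u<w _ _) = record
          { A = A ; B = B ; A⊆W = ⊆-trans A⊆ (U⊆W _) ; B⊆W = ⊆-trans B⊆ (U⊆W _)
          ; A≺B = ≺-⊆ A⊆ B⊆ (ordered u<w) ; A-large = A-size ; B-large = B-size ; sparse = both }
        oriented (tri≈ _ u≡w _) = contradiction (E-adj adjacent) (OrderedGraph.irrefl H u≡w)
        oriented (tri> _ _ w<u) = record
          { A = B ; B = A ; A⊆W = ⊆-trans B⊆ (U⊆W _) ; B⊆W = ⊆-trans A⊆ (U⊆W _)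
          ; A≺B = ≺-⊆ B⊆ A⊆ (ordered w<u) ; A-large = B-size ; B-large = A-size
          ; sparse = ≤-trans (≤-reflexive (cong (n ^ s *_) (edges-sym (below-sym (suc k)) B A)))
                       (≤-trans both (≤-reflexive (*-comm (length A) (length B)))) }

      copy-or-pair : MonochromaticCopy H c ⊎ Pair (below (suc k)) (n ^ s) M W
      copy-or-pair with embed (below k) (below-sym k) (coloured? k) n μ R C Θ μ>0 R>0 initial
                              ≤-refl (>-nonZero⁻¹ n {{n≢0}}) (cong (n +_) (sym (+-identityʳ n)))
      ... | inj₁ emb = inj₁ (from-embedding emb)
      ... | inj₂ sp  = inj₂ (from-sparse sp)

    pairs : ∀ {f} → HasBlocks (below k) D (MonochromaticCopy H c) L f →
            HasPairs (below (suc k)) (n ^ s) (MonochromaticCopy H c) (f * (n * (2 * n * R ^ d)))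
    pairs {f} hasBlocks M W M>0 sorted le
      with hasBlocks (n * (2 * n * M * R ^ d)) W
             (*-mono-≤ (>-nonZero⁻¹ n {{n≢0}}) (*-mono-≤ (*-mono-≤ (>-nonZero⁻¹ (2 * n) {{m*n≢0 2 n {{_}} {{n≢0}}}}) M>0)
                                                      (m^n>0 R {{>-nonZero R>0}} d)))
             sorted (≤-trans (≤-reflexive (lemma f n M (R ^ d))) le)
      where
      lemma : ∀ f n M r → f * (n * (2 * n * M * r)) ≡ f * (n * (2 * n * r)) * M
      lemma = solve-∀
    ... | inj₁ stop   = inj₁ stop
    ... | inj₂ blocks = copy-or-pair M>0 (layout H intervals L χ≤2^L (below k) D sorted blocks)

-- Growth of the exponents over the colours.

HasBlocks-mono : ∀ {v} {z : Fin v → Fin v → ℕ} {D Stop l f f′} → f ≤ f′ →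
                 HasBlocks z D Stop l f → HasBlocks z D Stop l f′
HasBlocks-mono f≤f′ has M W M>0 sorted le = has M W M>0 sorted (≤-trans (*-monoˡ-≤ M f≤f′) le)

-- Blocks of size M in which the colours below k have density n ^ -s are found
-- in every set of at least n ^ cost k s * M vertices.
cost : (L p′ d : ℕ) → ℕ → ℕ → ℕ
cost L p′ d zero    s = 6
cost L p′ d (suc k) s = L * (cost L p′ d k (suc p′ * s + 15 * p′) + (4 + (s + 3) * d))

-- The extra summand on the left makes the induction close: `s + 15` is multiplied by `suc p′`, at
-- least 2, so the slack for the next `s` covers both the cost of this round and the slack still
-- owed.
cost-bound : ∀ L p′ d k s → 0 < L → 0 < p′ → 0 < d →
             cost L p′ d (suc k) s + d * L ^ suc k * (s + 15) ≤ 2 * (d * L ^ suc k * suc p′ ^ k * (s + 15))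
cost-bound L p′ d zero s L>0 _ d>0 = begin
  L * (6 + (4 + (s + 3) * d)) + d * (L * 1) * (s + 15)       ≤⟨ +-monoˡ-≤ _ (*-monoʳ-≤ L (+-monoˡ-≤ ((s + 3) * d) (≤-trans (m≤m+n 10 2) (*-monoʳ-≤ 12 d>0)))) ⟩
  L * (12 * d + (s + 3) * d) + d * (L * 1) * (s + 15)        ≡⟨ lemma L d s ⟩
  2 * (d * (L * 1) * 1 * (s + 15))                           ∎
  where
  open ≤-Reasoning
  lemma : ∀ L d s → L * (12 * d + (s + 3) * d) + d * (L * 1) * (s + 15) ≡ 2 * (d * (L * 1) * 1 * (s + 15))
  lemma = solve-∀
cost-bound L p′ d (suc k) s L>0 p′>0 d>0 = begin
  L * (x + (4 + (s + 3) * d)) + d * (L * Λ) * S   ≤⟨ +-monoˡ-≤ _ (*-monoʳ-≤ L (+-monoʳ-≤ x small)) ⟩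
  L * (x + d * Λ * S) + d * (L * Λ) * S           ≡⟨ lemma₁ L x d Λ S ⟩
  L * (x + (d * Λ * S + d * Λ * S))               ≤⟨ *-monoʳ-≤ L (+-monoʳ-≤ x double) ⟩
  L * (x + d * Λ * (s′ + 15))                     ≤⟨ *-monoʳ-≤ L (cost-bound L p′ d k s′ L>0 p′>0 d>0) ⟩
  L * (2 * (d * Λ * suc p′ ^ k * (s′ + 15)))      ≡⟨ lemma₃ L d Λ (suc p′ ^ k) p′ s ⟩
  2 * (d * (L * Λ) * (suc p′ * suc p′ ^ k) * S)   ∎
  where
  open ≤-Reasoning
  s′ = suc p′ * s + 15 * p′
  S  = s + 15
  Λ  = L ^ suc k
  x  = cost L p′ d (suc k) s′
  lemma₁ : ∀ L x d Λ S → L * (x + d * Λ * S) + d * (L * Λ) * S ≡ L * (x + (d * Λ * S + d * Λ * S))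
  lemma₁ = solve-∀
  lemma₂ : ∀ p s y → y * (s + 15) + p * (y * (s + 15)) ≡ y * (suc p * s + 15 * p + 15)
  lemma₂ = solve-∀
  lemma₃ : ∀ L d Λ P p s → L * (2 * (d * Λ * P * (suc p * s + 15 * p + 15))) ≡ 2 * (d * (L * Λ) * (suc p * P) * (s + 15))
  lemma₃ = solve-∀
  lemma₄ : ∀ s d → 4 * d + (s + 3) * d + 8 * d ≡ d * 1 * (s + 15)
  lemma₄ = solve-∀
  small : 4 + (s + 3) * d ≤ d * Λ * S
  small = begin
    4 + (s + 3) * d               ≤⟨ +-monoˡ-≤ ((s + 3) * d) (*-monoʳ-≤ 4 d>0) ⟩
    4 * d + (s + 3) * d           ≤⟨ m≤m+n _ (8 * d) ⟩
    4 * d + (s + 3) * d + 8 * d   ≡⟨ lemma₄ s d ⟩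
    d * 1 * S                     ≤⟨ *-monoˡ-≤ S (*-monoʳ-≤ d (m^n>0 L {{>-nonZero L>0}} (suc k))) ⟩
    d * Λ * S                     ∎
  double : d * Λ * S + d * Λ * S ≤ d * Λ * (s′ + 15)
  double = begin
    d * Λ * S + d * Λ * S           ≡⟨ cong (d * Λ * S +_) (*-identityˡ (d * Λ * S)) ⟨
    d * Λ * S + 1 * (d * Λ * S)     ≤⟨ +-monoʳ-≤ (d * Λ * S) (*-monoˡ-≤ (d * Λ * S) p′>0) ⟩
    d * Λ * S + p′ * (d * Λ * S)    ≡⟨ lemma₂ p′ s (d * Λ) ⟩
    d * Λ * (s′ + 15)               ∎

-- For `s = 7`, `cost-bound` gives at most 44 `X`. The successor, which pays for final blocks of
-- size `n`, adds at most `X`, and 45 ≤ 60.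
exponent-bound : ∀ L p′ d k → 0 < L → 0 < p′ → 0 < d →
                 suc (cost L p′ d (suc k) 7) ≤ 60 * d * suc p′ ^ k * L ^ suc k
exponent-bound L p′ d k L>0 p′>0 d>0 = begin
  1 + cost L p′ d (suc k) 7              ≤⟨ +-mono-≤ X>0 (≤-trans (m≤m+n (cost L p′ d (suc k) 7) _) (cost-bound L p′ d k 7 L>0 p′>0 d>0)) ⟩
  X + 2 * (d * Λ * P * 22)               ≤⟨ m≤m+n _ (15 * X) ⟩
  X + 2 * (d * Λ * P * 22) + 15 * X      ≡⟨ lemma d Λ P ⟩
  60 * d * P * Λ                         ∎
  where
  open ≤-Reasoning
  Λ = L ^ suc k
  P = suc p′ ^ k
  X = d * Λ * P
  X>0 : 1 ≤ X
  X>0 = *-mono-≤ (*-mono-≤ d>0 (m^n>0 L {{>-nonZero L>0}} (suc k))) (m^n>0 (suc p′) k)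
  lemma : ∀ d Λ P → d * Λ * P + 2 * (d * Λ * P * 22) + 15 * (d * Λ * P) ≡ 60 * d * P * Λ
  lemma = solve-∀

-- Induction over the colours, and the last colour.

module _ {n χ} (H : OrderedGraph n) (intervals : IndependentIntervalPartition H χ)
         (L : ℕ) (χ≤2^L : χ ≤ 2 ^ L) (2^L≤n³ : 2 ^ suc L ≤ n ^ 3) (3≤n : 3 ≤ n)
         (π : Permutation′ n) {d p′ : ℕ} (0<p′ : 0 < p′)
         (degrees : IsDegeneracyOrdering H π d) (codegrees : BackCodegreesAtMost H π p′)
         {v q} (c : EdgeColouring (complete v) q) where
  open EdgeColouring c using (colour)
  open Colouring H intervals L χ≤2^L 2^L≤n³ 3≤n π 0<p′ degrees codegrees c
  open ≤-Reasoning

  -- With no colours treated yet there is nothing to count, so cutting a sorted list in two already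
  -- gives a sparse pair.
  split : ∀ D → HasPairs (below 0) D (MonochromaticCopy H c) 2
  split D M W _ sorted le = inj₂ (record
    { A = take M W ; B = drop M W ; A⊆W = take-⊆ M W ; B⊆W = drop-⊆ M W
    ; A≺B = take-drop-related sorted M
    ; A-large = ≤-reflexive (sym (trans (length-take M W) (m≤n⇒m⊓n≡m (≤-trans (m≤m+n M _) le))))
    ; B-large = begin
        M                      ≡⟨ m+n∸n≡m M M ⟨
        M + M ∸ M              ≡⟨ cong (λ x → M + x ∸ M) (+-identityʳ M) ⟨
        2 * M ∸ M              ≤⟨ ∸-monoˡ-≤ M le ⟩
        length W ∸ M           ≡⟨ length-drop M W ⟨
        length (drop M W)      ∎
    ; sparse = begin
        D * edges (below 0) (take M W) (drop M W)   ≡⟨ cong (D *_) (no-edges (take M W) (drop M W)) ⟩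
        D * 0                                       ≡⟨ *-zeroʳ D ⟩
        0                                           ≤⟨ z≤n ⟩
        length (take M W) * length (drop M W)       ∎ })
    where
    zeros : ∀ {A : Set} (xs : List A) → total (λ _ → 0) xs ≡ 0
    zeros xs = trans (total-const 0 xs) (*-zeroʳ (length xs))
    no-edges : ∀ (xs ys : List (Fin v)) → edges (below 0) xs ys ≡ 0
    no-edges xs ys = trans (total-cong xs (λ _ → zeros ys)) (zeros xs)

  -- Blocks at the sharper density for `k` colours give pairs for `suc k` colours, and these give
  -- blocks again.
  has-blocks : ∀ k s → k ≤ q → HasBlocks (below k) (n ^ s) (MonochromaticCopy H c) L (n ^ cost L p′ d k s)
  has-blocks zero s _ = HasBlocks-mono (begin
    (2 * 2) ^ L          ≡⟨ trans (^-*-assoc 2 2 L) (trans (cong (2 ^_) (*-comm 2 L)) (sym (^-*-assoc 2 L 2))) ⟩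
    (2 ^ L) ^ 2          ≤⟨ ^-monoˡ-≤ 2 (≤-trans (m≤m+n (2 ^ L) _) 2^L≤n³) ⟩
    (n ^ 3) ^ 2          ≡⟨ ^-*-assoc n 3 2 ⟩
    n ^ 6                ∎)
    (pairs⇒blocks (below 0) (n ^ s) (below-sym 0) {f = 2} (s≤s z≤n) (split (n ^ s)) L)
  has-blocks (suc k) s k<q = HasBlocks-mono (begin
    (2 * f) ^ L                                   ≤⟨ ^-monoˡ-≤ L 2f≤ ⟩
    (n ^ (x + (4 + (s + 3) * d))) ^ L             ≡⟨ ^-*-assoc n (x + (4 + (s + 3) * d)) L ⟩
    n ^ ((x + (4 + (s + 3) * d)) * L)             ≡⟨ cong (n ^_) (*-comm _ L) ⟩
    n ^ (L * (x + (4 + (s + 3) * d)))             ∎)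
    (pairs⇒blocks (below (suc k)) (n ^ s) (below-sym (suc k)) f>0
      (pairs {n ^ x} (has-blocks k (suc p′ * s + 15 * p′) (<⇒≤ k<q))) L)
    where
    open Pairs k s k<q
    x = cost L p′ d k (suc p′ * s + 15 * p′)
    f = n ^ x * (n * (2 * n * R ^ d))
    n>0 : 0 < n
    n>0 = >-nonZero⁻¹ n {{n≢0}}
    f>0 : 0 < f
    f>0 = *-mono-≤ (m^n>0 n {{n≢0}} x) (*-mono-≤ n>0 (*-mono-≤ (*-mono-≤ {1} {2} (s≤s z≤n) n>0) (m^n>0 R {{>-nonZero R>0}} d)))
    lemma₁ : ∀ n x r → 2 * (x * (n * (2 * n * r))) ≡ 4 * (n * n * x * r)
    lemma₁ = solve-∀
    lemma₂ : ∀ n x r → n * (n * 1) * (n * n * x * r) ≡ x * (n * (n * (n * (n * 1))) * r)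
    lemma₂ = solve-∀
    -- The constant 4 and two factors `n` fit into `n ^ 4`, the 4 in `cost`.
    2f≤ : 2 * f ≤ n ^ (x + (4 + (s + 3) * d))
    2f≤ = begin
      2 * f                                       ≡⟨ lemma₁ n (n ^ x) (R ^ d) ⟩
      4 * (n * n * n ^ x * R ^ d)                 ≤⟨ *-monoˡ-≤ (n * n * n ^ x * R ^ d) 4≤n² ⟩
      n ^ 2 * (n * n * n ^ x * R ^ d)             ≡⟨ lemma₂ n (n ^ x) (R ^ d) ⟩
      n ^ x * (n ^ 4 * R ^ d)                     ≡⟨ cong (λ r → n ^ x * (n ^ 4 * r)) (^-*-assoc n (s + 3) d) ⟩
      n ^ x * (n ^ 4 * n ^ ((s + 3) * d))         ≡⟨ cong (n ^ x *_) (^-distribˡ-+-* n 4 ((s + 3) * d)) ⟨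
      n ^ x * n ^ (4 + (s + 3) * d)               ≡⟨ ^-distribˡ-+-* n x (4 + (s + 3) * d) ⟨
      n ^ (x + (4 + (s + 3) * d))                 ∎

  -- All colours but the last are so sparse between the blocks that they are absent, so one
  -- arbitrary point from each candidate set gives a copy in the last colour.
  monochromatic-copy : ∀ k → q ≡ suc k → n ^ suc (cost L p′ d k 7) ≤ v → MonochromaticCopy H c
  monochromatic-copy k q≡ large
    with has-blocks k 7 (≤-trans (n≤1+n k) (≤-reflexive (sym q≡))) (n * 1) (allFin v)
           (*-mono-≤ (>-nonZero⁻¹ n {{n≢0}}) (≤-refl {1})) (AllPairsₚ.tabulate⁺-< id)
           (≤-trans (≤-reflexive (lemma n (n ^ cost L p′ d k 7))) (≤-trans large (≤-reflexive (sym (length-tabulate id)))))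
    where
    lemma : ∀ n x → x * (n * 1) ≡ n * x
    lemma = solve-∀
  ... | inj₁ copy   = copy
  ... | inj₂ blocks = monochromatic H c f (fromℕ< k<q) (λ {u} {w} u<w → ordered u<w (f∈U u) (f∈U w)) shaded
    where
    open Layout (layout H intervals L χ≤2^L (below k) (n ^ 7) (AllPairsₚ.tabulate⁺-< id) blocks)
    k<q : k < q
    k<q = ≤-reflexive (sym q≡)
    point : ∀ u → ∃[ x ] x ∈ U u
    point u = nonempty (U u) (≤-reflexive (sym (size u)))
    f : Fin n → Fin v
    f u = proj₁ (point u)
    f∈U : ∀ u → f u ∈ U u
    f∈U u = proj₂ (point u)
    few : ∀ e → n ^ 7 * e ≤ 2 ^ suc L * (n * 1 * (n * 1)) → e ≡ 0
    few zero    _  = refl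
    -- A single edge of an earlier colour would give `n ^ 7` ≤ `n ^ 5`.
    few (suc e) le = contradiction (begin
      n ^ 7                           ≤⟨ m≤m*n (n ^ 7) (suc e) ⟩
      n ^ 7 * suc e                   ≤⟨ le ⟩
      2 ^ suc L * (n * 1 * (n * 1))   ≤⟨ *-monoˡ-≤ (n * 1 * (n * 1)) 2^L≤n³ ⟩
      n ^ 3 * (n * 1 * (n * 1))       ≡⟨ lemma n ⟩
      n ^ 5                           ∎) (<⇒≱ (^-monoʳ-< n (≤-trans (s≤s (s≤s z≤n)) 3≤n) {5} {7} (m≤m+n 6 1)))
      where
      lemma : ∀ n → n * (n * (n * 1)) * (n * 1 * (n * 1)) ≡ n * (n * (n * (n * (n * 1))))
      lemma = solve-∀
    shaded : ∀ {u w} → u <ᶠ w → Adj H u w → colour (f u) (f w) ≡ fromℕ< k<q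
    shaded {u} {w} u<w u~w = toℕ-injective (trans (≤-antisym
      (s≤s⁻¹ (≤-trans (toℕ<n (colour (f u) (f w))) (≤-reflexive q≡)))
      (below≡0 k (n≤0⇒n≡0 (begin
        below k (f u) (f w)          ≤⟨ term≤total (below k (f u)) (f∈U w) ⟩
        total (below k (f u)) (U w)  ≤⟨ term≤total (λ x → total (below k x) (U w)) (f∈U u) ⟩
        edges (below k) (U u) (U w)  ≡⟨ few _ (sparse u<w u~w) ⟩
        0                            ∎))))
      (sym (toℕ-fromℕ< k<q)))

-- Rounded binary logarithms.

m≤2^⌈log₂m⌉ : ∀ m → m ≤ 2 ^ ⌈log₂ m ⌉
m≤2^⌈log₂m⌉ = <-rec _ step
  where
  open ≤-Reasoning
  step : ∀ m → (∀ {k} → k < m → k ≤ 2 ^ ⌈log₂ k ⌉) → m ≤ 2 ^ ⌈log₂ m ⌉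
  step zero _ = z≤n
  step (suc zero) _ = m^n>0 2 ⌈log₂ 1 ⌉
  step m@(suc (suc k)) ih = begin
    m                              ≡⟨ ⌊n/2⌋+⌈n/2⌉≡n m ⟨
    ⌊ m /2⌋ + ⌈ m /2⌉              ≤⟨ +-monoˡ-≤ ⌈ m /2⌉ (⌊n/2⌋≤⌈n/2⌉ m) ⟩
    ⌈ m /2⌉ + ⌈ m /2⌉              ≡⟨ cong (⌈ m /2⌉ +_) (+-identityʳ _) ⟨
    2 * ⌈ m /2⌉                    ≤⟨ *-monoʳ-≤ 2 (ih (⌈n/2⌉<n k)) ⟩
    2 ^ suc ⌈log₂ ⌈ m /2⌉ ⌉        ≡⟨ cong (λ l → 2 ^ suc l) (⌈log₂⌈n/2⌉⌉≡⌈log₂n⌉∸1 m) ⟩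
    2 ^ suc (⌈log₂ m ⌉ ∸ 1)        ≡⟨ cong (2 ^_) (m+[n∸m]≡n {1} (log≥1 m (s≤s (s≤s z≤n)))) ⟩
    2 ^ ⌈log₂ m ⌉                  ∎
    where
    log≥1 : ∀ m → 2 ≤ m → 1 ≤ ⌈log₂ m ⌉
    log≥1 m 2≤m = ≤-trans (≤-reflexive (sym (⌈log₂2^n⌉≡n 1))) (⌈log₂⌉-mono-≤ 2≤m)

2^⌈log₂m⌉≤2m : ∀ m → 0 < m → 2 ^ ⌈log₂ m ⌉ ≤ 2 * m
2^⌈log₂m⌉≤2m m m>0 = ≮⇒≥ (λ lt → impossible ⌈log₂ m ⌉ refl lt)
  where
  impossible : ∀ l → ⌈log₂ m ⌉ ≡ l → ¬ (2 * m < 2 ^ l)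
  impossible zero    _  lt = <⇒≱ lt (≤-trans m>0 (m≤m+n m _))
  impossible (suc l) eq lt = <⇒≱ (≤-reflexive (sym eq))
    (≤-trans (⌈log₂⌉-mono-≤ (<⇒≤ (*-cancelˡ-< 2 m (2 ^ l) lt))) (≤-reflexive (⌈log₂2^n⌉≡n l)))

-- Deciding the Ramsey property, and taking the least number.

Searchable : Set → Set₁
Searchable A = ∀ {P : A → Set} → (∀ a → Dec (P a)) → Dec (∃[ a ] P a)

vec-searchable : ∀ {A} → Searchable A → ∀ n → Searchable (Vec A n)
vec-searchable search zero    P? = map′ (λ p → [] , p) (λ { ([] , p) → p }) (P? [])
vec-searchable search (suc n) P? = map′ (λ { (a , as , p) → a ∷ as , p }) (λ { (a ∷ as , p) → a , as , p })
  (search (λ a → vec-searchable search n (λ as → P? (a ∷ as))))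

least-below : {P : ℕ → Set} → (∀ m → Dec (P m)) → ∀ N →
              (∃[ r ] (IsLeast P r × r < N)) ⊎ (∀ {k} → k < N → ¬ P k)
least-below P? zero = inj₂ λ ()
least-below P? (suc N) with least-below P? N
... | inj₁ (r , least , r<N) = inj₁ (r , least , m<n⇒m<1+n r<N)
... | inj₂ none with P? N
... | yes p = inj₁ (N , (p , λ k pk → ≮⇒≥ (λ k<N → none k<N pk)) , ≤-refl)
... | no ¬p = inj₂ λ {k} k<1+N pk → case (m≤n⇒m<n∨m≡n (s≤s⁻¹ k<1+N)) pk
  where
  case : ∀ {k} → k < N ⊎ k ≡ N → ¬ _
  case (inj₁ k<N)  = none k<N
  case (inj₂ refl) = ¬p

least≤ : {P : ℕ → Set} → (∀ m → Dec (P m)) → ∀ {N} → P N → ∃[ r ] (IsLeast P r × r ≤ N)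
least≤ P? {N} p with least-below P? (suc N)
... | inj₁ (r , least , r<1+N) = r , least , s≤s⁻¹ r<1+N
... | inj₂ none = contradiction p (none ≤-refl)

module _ {n} (H : OrderedGraph n) {N q : ℕ} where

  -- Maps are given as vectors so that all of them can be searched.
  HasCopy : (Fin N → Fin N → Fin q) → Set
  HasCopy colour = ∃[ f ] ∃[ a ] ((∀ u w → u <ᶠ w → Vec.lookup f u <ᶠ Vec.lookup f w)
    × (∀ u w → Adj H u w → colour (Vec.lookup {n = n} f u) (Vec.lookup f w) ≡ a))

  hasCopy? : ∀ colour → Dec (HasCopy colour)
  hasCopy? colour = vec-searchable any? n λ f → any? λ a →
    all? (λ u → all? (λ w → (u <ᶠ? w) →-dec (Vec.lookup f u <ᶠ? Vec.lookup f w))) ×-dec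
    all? (λ u → all? (λ w → Adj? H u w →-dec (colour (Vec.lookup f u) (Vec.lookup f w) ≟ᶠ a)))

  fromHasCopy : (c : EdgeColouring (complete N) q) → ∀ {colour} →
                (∀ x y → EdgeColouring.colour c x y ≡ colour x y) → HasCopy colour → MonochromaticCopy H c
  fromHasCopy c same (f , a , increasing , shaded) =
    monochromatic H c (Vec.lookup f) a (increasing _ _) (λ _ u~w → trans (same _ _) (shaded _ _ u~w))

  toHasCopy : {c : EdgeColouring (complete N) q} → MonochromaticCopy H c → HasCopy (EdgeColouring.colour c)
  toHasCopy {c} copy = Vec.tabulate map , shade ,
    (λ u w u<w → subst₂ _<ᶠ_ (sym (lookup∘tabulate map u)) (sym (lookup∘tabulate map w)) (increasing u<w)) ,
    (λ u w u~w → subst₂ (λ x y → EdgeColouring.colour c x y ≡ shade) (sym (lookup∘tabulate map u))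
                        (sym (lookup∘tabulate map w)) (monochromatic′ u~w))
    where open MonochromaticCopy copy renaming (monochromatic to monochromatic′)

  Matrix : Set
  Matrix = Vec (Vec (Fin q) N) N

  entry : Matrix → Fin N → Fin N → Fin q
  entry A x y = Vec.lookup (Vec.lookup A x) y

  -- Search for a symmetric matrix of colours without a copy. Every colouring agrees pointwise with
  -- its matrix, which is enough to carry a copy over.
  ramsey? : Dec ((c : EdgeColouring (complete N) q) → MonochromaticCopy H c)
  ramsey? = decide (vec-searchable (vec-searchable any? N) N λ A →
      all? (λ x → all? (λ y → entry A x y ≟ᶠ entry A y x)) ×-dec ¬? (hasCopy? (entry A)))
    where
    decide : Dec (∃[ A ] ((∀ x y → entry A x y ≡ entry A y x) × ¬ HasCopy (entry A))) →
             Dec ((c : EdgeColouring (complete N) q) → MonochromaticCopy H c)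
    decide (yes (A , A-sym , ¬copy)) = no λ all → ¬copy (toHasCopy (all (record { colour = entry A ; sym = A-sym })))
    decide (no none) = yes λ c → let open EdgeColouring c renaming (sym to colour-sym) in
      copyOf c (hasCopy? (entry (matrix colour)))
      where
      matrix : (Fin N → Fin N → Fin q) → Matrix
      matrix colour = Vec.tabulate (λ x → Vec.tabulate (colour x))
      same : ∀ colour x y → colour x y ≡ entry (matrix colour) x y
      same colour x y = sym (trans (cong (λ v → Vec.lookup v y) (lookup∘tabulate _ x)) (lookup∘tabulate (colour x) y))
      copyOf : ∀ c → Dec (HasCopy (entry (matrix (EdgeColouring.colour c)))) → MonochromaticCopy H c
      copyOf c (yes copy) = fromHasCopy c (same (EdgeColouring.colour c)) copy
      copyOf c (no ¬copy) = contradiction (matrix colour , (λ x y →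
        trans (sym (same colour x y)) (trans (colour-sym x y) (same colour y x))) , ¬copy) none
        where open EdgeColouring c renaming (sym to colour-sym)

-- The bound itself has the Ramsey property, so the least number with this decidable property exists
-- and does not exceed it.
theorem3 : (d q n p χ : ℕ) → 2 ≤ d → 2 ≤ q → 3 ≤ n → 2 ≤ p →
    (H : OrderedGraph n) →
    IsDegenerate d H →
    (∃[ u ] ∃[ v ] Adj H u v) →
    IsIntervalChromaticNumber H χ →
    (π : Permutation′ n) →
    IsDegeneracyOrdering H π d →
    BackCodegreesAtMost H π (p ∸ 1) →
    ∃[ r ] (IsOrderedRamseyNumber H q r × r ≤ n ^ (60 * d * p ^ (q ∸ 2) * ⌈log₂ χ ⌉ ^ (q ∸ 1)))
theorem3 d (suc (suc k)) n (suc p′) χ 2≤d (s≤s (s≤s _)) 3≤n (s≤s 0<p′) H _ (u , v , u~v) (intervals , _) π degrees codegrees =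
  least≤ (λ N → ramsey? H) (λ c → monochromatic-copy H intervals L (m≤2^⌈log₂m⌉ χ) 2^L≤n³ 3≤n π 0<p′ degrees codegrees c
    (suc k) refl (^-monoʳ-≤ n {{>-nonZero (≤-trans (s≤s z≤n) 3≤n)}} (exponent-bound L p′ d k L>0 0<p′ (≤-trans (s≤s z≤n) 2≤d))))
  where
  open IndependentIntervalPartition intervals
  open ≤-Reasoning
  L = ⌈log₂ χ ⌉

  2≤χ : ∀ {χ} (a b : Fin χ) → a ≢ b → 2 ≤ χ
  2≤χ {suc zero} zero zero a≢b = contradiction refl a≢b
  2≤χ {suc (suc χ)} _ _ _ = s≤s (s≤s z≤n)

  -- The ends of an edge lie in different intervals. Hence `L` is positive, as the exponent
  -- estimates require.
  χ≥2 : 2 ≤ χ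
  χ≥2 = 2≤χ (part u) (part v) (λ eq → independent eq u~v)

  L>0 : 0 < L
  L>0 = ≤-trans (≤-reflexive (sym (⌈log₂2^n⌉≡n 1))) (⌈log₂⌉-mono-≤ χ≥2)

  -- No interval is empty, and choosing a vertex from each is injective.
  χ≤n : χ ≤ n
  χ≤n = ≮⇒≥ λ n<χ → collide (pigeonhole n<χ section)
    where
    section : Fin χ → Fin n
    section a = proj₁ (surjective a)
    collide : ¬ (∃[ a ] ∃[ b ] (a <ᶠ b × section a ≡ section b))
    collide (a , b , a<b , eq) = <⇒≢ a<b (cong toℕ
      (trans (sym (proj₂ (surjective a) refl)) (trans (cong part eq) (proj₂ (surjective b) refl))))

  2^L≤n³ : 2 ^ suc L ≤ n ^ 3
  2^L≤n³ = begin
    2 * 2 ^ L        ≤⟨ *-monoʳ-≤ 2 (2^⌈log₂m⌉≤2m χ (≤-trans (s≤s z≤n) χ≥2)) ⟩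
    2 * (2 * χ)      ≤⟨ *-monoʳ-≤ 2 (*-monoʳ-≤ 2 χ≤n) ⟩
    2 * (2 * n)      ≡⟨ *-assoc 2 2 n ⟨
    4 * n            ≤⟨ *-monoˡ-≤ n (≤-trans (m≤m+n 4 5) (^-monoˡ-≤ 2 3≤n)) ⟩
    n ^ 2 * n        ≡⟨ *-comm (n ^ 2) n ⟩
    n ^ 3            ∎
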